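{- For every $i\ge1$, $\mathsf{T}^i_{\mathsf{PV}}$ proves every $\forall\Sigma^b_{i-1}$-sentence of $\mathcal{L}_{\mathsf{PV}}$ that is true in $\mathbb{N}$, even when sharply bounded quantifiers are allowed to appear arbitrarily in the sentence.
   Context: $\mathcal{L}_{\mathsf{PV}}$ has constants $0,1$, equality as the only relation, and a function symbol for every polynomial-time computable $f:\mathbb{N}^k\to\mathbb{N}$, including the bit-length function $|x|$. A bounded quantifier is $\exists x\le t$ or $\forall x\le t$ ($t$ a term not containing $x$); a sharply bounded quantifier is one of the form $\exists x\le|t|$ or $\forall x\le|t|$. The strict classes $\Sigma^b_j,\Pi^b_j$: $\Sigma^b_0=\Pi^b_0$ are quantifier-free formulas; $\Sigma^b_j,\Pi^b_j$ are the smallest classes containing $\Sigma^b_{j-1}\cup\Pi^b_{j-1}$, closed under $\wedge,\vee$, $\Sigma^b_j$ under bounded $\exists$, $\Pi^b_j$ under bounded $\forall$, negation exchanging them. $\mathsf{T}^i_{\mathsf{PV}}$ is the theory of all strict $\forall\Sigma^b_{i-1}$-sentences ($\forall\vec y\,\varphi$ with $\varphi$ strict $\Sigma^b_{i-1}$) true in $\mathbb{N}$. "Sharply bounded quantifiers allowed arbitrarily" means the classes are additionally closed under sharply bounded quantification of either kind at any position, without this counting toward the level of the hierarchy. -}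

module Defs where

open import Data.Nat using (ℕ; zero; suc; _+_; _*_; _^_; _≤_; _<_; _≤ᵇ_; _∸_)
open import Data.Nat.Logarithm using (⌈log₂_⌉)
open import Data.Bool using (if_then_else_)
open import Data.Fin using (Fin; zero; suc)
open import Data.Vec using (Vec; []; _∷_; lookup; tabulate)
open import Data.List using (List; []; _∷_; map)
open import Data.List.Membership.Propositional using (_∈_)
open import Data.Product using (Σ; _×_; ∃)
open import Data.Sum using (_⊎_)
open import Data.Empty using (⊥)
open import Relation.Nullary using (¬_)
open import Relation.Binary.PropositionalEquality using (_≡_)

bitLength : ℕ → ℕ
bitLength n = ⌈log₂ (suc n) ⌉

-- Polynomial-time computable functions, via Cobham's characterisation
-- (FP = closure of 0, s₀, s₁, projections, smash under composition and
-- limited recursion on notation).  Given as a predicate on functions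
-- Vec ℕ k → ℕ, closed under extensional equality.

data Cobham : (k : ℕ) → (Vec ℕ k → ℕ) → Set where
  c-zero : ∀ {k f} → (∀ v → f v ≡ 0) → Cobham k f
  c-s0   : ∀ {f} → (∀ x → f (x ∷ []) ≡ 2 * x) → Cobham 1 f
  c-s1   : ∀ {f} → (∀ x → f (x ∷ []) ≡ suc (2 * x)) → Cobham 1 f
  c-proj : ∀ {k f} (i : Fin k) → (∀ v → f v ≡ lookup v i) → Cobham k f
  c-smash : ∀ {f} →
    (∀ x y → f (x ∷ y ∷ []) ≡ 2 ^ (bitLength x * bitLength y)) → Cobham 2 f
  c-comp : ∀ {k m f} (g : Vec ℕ m → ℕ) (hs : Fin m → Vec ℕ k → ℕ) →
    Cobham m g → ((i : Fin m) → Cobham k (hs i)) →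
    (∀ v → f v ≡ g (tabulate (λ i → hs i v))) → Cobham k f
  c-lrn : ∀ {k f} (g : Vec ℕ k → ℕ) (h0 h1 : Vec ℕ (suc (suc k)) → ℕ)
    (b : Vec ℕ (suc k) → ℕ) →
    Cobham k g → Cobham (suc (suc k)) h0 → Cobham (suc (suc k)) h1 →
    Cobham (suc k) b →
    (∀ ys → f (0 ∷ ys) ≡ g ys) →
    (∀ x ys → 0 < x → f (2 * x ∷ ys) ≡ h0 (x ∷ f (x ∷ ys) ∷ ys)) →
    (∀ x ys → f (suc (2 * x) ∷ ys) ≡ h1 (x ∷ f (x ∷ ys) ∷ ys)) →
    (∀ x ys → f (x ∷ ys) ≤ b (x ∷ ys)) →
    Cobham (suc k) f

record Sym (k : ℕ) : Set where
  constructor sym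
  field
    fn   : Vec ℕ k → ℕ
    poly : Cobham k fn
open Sym public

IsLeq : Sym 2 → Set
IsLeq s = ∀ a b → fn s (a ∷ b ∷ []) ≡ (if a ≤ᵇ b then 1 else 0)

IsLen : Sym 1 → Set
IsLen l = ∀ a → fn l (a ∷ []) ≡ bitLength a

data Term (n : ℕ) : Set where
  var : Fin n → Term n
  𝟘 𝟙 : Term n
  app : ∀ {k} → Sym k → Vec (Term n) k → Term n

infix 7 _≐_
infixr 6 _∧'_
infixr 5 _∨'_

data Form : ℕ → Set where
  _≐_  : ∀ {n} → Term n → Term n → Form n
  ⊥'   : ∀ {n} → Form n
  ¬'_  : ∀ {n} → Form n → Form n
  _∧'_ : ∀ {n} → Form n → Form n → Form n
  _∨'_ : ∀ {n} → Form n → Form n → Form n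
  ∀'   : ∀ {n} → Form (suc n) → Form n
  ∃'   : ∀ {n} → Form (suc n) → Form n

ext : ∀ {n m} → (Fin n → Fin m) → Fin (suc n) → Fin (suc m)
ext ρ zero = zero
ext ρ (suc i) = suc (ρ i)

mutual
  renT : ∀ {n m} → (Fin n → Fin m) → Term n → Term m
  renT ρ (var i) = var (ρ i)
  renT ρ 𝟘 = 𝟘
  renT ρ 𝟙 = 𝟙
  renT ρ (app f ts) = app f (renTs ρ ts)

  renTs : ∀ {n m k} → (Fin n → Fin m) → Vec (Term n) k → Vec (Term m) k
  renTs ρ [] = []
  renTs ρ (t ∷ ts) = renT ρ t ∷ renTs ρ ts

renF : ∀ {n m} → (Fin n → Fin m) → Form n → Form m
renF ρ (s ≐ t) = renT ρ s ≐ renT ρ t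
renF ρ ⊥' = ⊥'
renF ρ (¬' φ) = ¬' renF ρ φ
renF ρ (φ ∧' ψ) = renF ρ φ ∧' renF ρ ψ
renF ρ (φ ∨' ψ) = renF ρ φ ∨' renF ρ ψ
renF ρ (∀' φ) = ∀' (renF (ext ρ) φ)
renF ρ (∃' φ) = ∃' (renF (ext ρ) φ)

exts : ∀ {n m} → (Fin n → Term m) → Fin (suc n) → Term (suc m)
exts σ zero = var zero
exts σ (suc i) = renT suc (σ i)

mutual
  subT : ∀ {n m} → (Fin n → Term m) → Term n → Term m
  subT σ (var i) = σ i
  subT σ 𝟘 = 𝟘
  subT σ 𝟙 = 𝟙
  subT σ (app f ts) = app f (subTs σ ts)

  subTs : ∀ {n m k} → (Fin n → Term m) → Vec (Term n) k → Vec (Term m) k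
  subTs σ [] = []
  subTs σ (t ∷ ts) = subT σ t ∷ subTs σ ts

subF : ∀ {n m} → (Fin n → Term m) → Form n → Form m
subF σ (s ≐ t) = subT σ s ≐ subT σ t
subF σ ⊥' = ⊥'
subF σ (¬' φ) = ¬' subF σ φ
subF σ (φ ∧' ψ) = subF σ φ ∧' subF σ ψ
subF σ (φ ∨' ψ) = subF σ φ ∨' subF σ ψ
subF σ (∀' φ) = ∀' (subF (exts σ) φ)
subF σ (∃' φ) = ∃' (subF (exts σ) φ)

single : ∀ {n} → Term n → Fin (suc n) → Term n
single t zero = t
single t (suc i) = var i

_[_] : ∀ {n} → Form (suc n) → Term n → Form n
φ [ t ] = subF (single t) φ

∀* : ∀ {m} → Form m → Form 0
∀* {zero} φ = φ
∀* {suc m} φ = ∀* (∀' φ)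

close→ : ∀ {n} → Form 0 → Form n
close→ = renF (λ ())

-- Bounded quantifiers (abbreviations).  x ≤ t is expressed by an
-- L_PV symbol s computing the characteristic function of ≤:
--   ∃x≤t φ  :=  ∃x (s(x,t) = 1 ∧ φ)
--   ∀x≤t φ  :=  ∀x (¬ s(x,t) = 1 ∨ φ)

leqF : ∀ {n} → Sym 2 → Term n → Term n → Form n
leqF s x t = app s (x ∷ t ∷ []) ≐ 𝟙

∃≤ : ∀ {n} → Sym 2 → Term n → Form (suc n) → Form n
∃≤ s t φ = ∃' (leqF s (var zero) (renT suc t) ∧' φ)

∀≤ : ∀ {n} → Sym 2 → Term n → Form (suc n) → Form n
∀≤ s t φ = ∀' (¬' leqF s (var zero) (renT suc t) ∨' φ)

data QF : ∀ {n} → Form n → Set where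
  qf-eq  : ∀ {n} {s t : Term n} → QF (s ≐ t)
  qf-⊥   : ∀ {n} → QF (⊥' {n})
  qf-¬   : ∀ {n} {φ : Form n} → QF φ → QF (¬' φ)
  qf-∧   : ∀ {n} {φ ψ : Form n} → QF φ → QF ψ → QF (φ ∧' ψ)
  qf-∨   : ∀ {n} {φ ψ : Form n} → QF φ → QF ψ → QF (φ ∨' ψ)

data Pol : Set where
  Σp Πp : Pol

dual : Pol → Pol
dual Σp = Πp
dual Πp = Σp

-- Cls sb p j φ : φ ∈ Σ^b_j (p = Σp) resp. Π^b_j (p = Πp).
-- sb = strict : the strict classes;  sb = sharp : in addition closed
-- under sharply bounded quantifiers (∃x≤|t|, ∀x≤|t|) at every level.
data Mode : Set where
  strict sharp : Mode

data Cls (sb : Mode) : Pol → ℕ → ∀ {n} → Form n → Set where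
  c-qf   : ∀ {p j n} {φ : Form n} → QF φ → Cls sb p j φ
  c-up   : ∀ {p q j n} {φ : Form n} → Cls sb q j φ → Cls sb p (suc j) φ
  c-∧    : ∀ {p j n} {φ ψ : Form n} →
           Cls sb p j φ → Cls sb p j ψ → Cls sb p j (φ ∧' ψ)
  c-∨    : ∀ {p j n} {φ ψ : Form n} →
           Cls sb p j φ → Cls sb p j ψ → Cls sb p j (φ ∨' ψ)
  c-¬    : ∀ {p j n} {φ : Form n} → Cls sb (dual p) j φ → Cls sb p j (¬' φ)
  c-∃≤   : ∀ {j n} (s : Sym 2) → IsLeq s → (t : Term n) {φ : Form (suc n)} →
           Cls sb Σp (suc j) φ → Cls sb Σp (suc j) (∃≤ s t φ)
  c-∀≤   : ∀ {j n} (s : Sym 2) → IsLeq s → (t : Term n) {φ : Form (suc n)} →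
           Cls sb Πp (suc j) φ → Cls sb Πp (suc j) (∀≤ s t φ)
  c-s∃   : ∀ {p j n} → sb ≡ sharp → (s : Sym 2) → IsLeq s →
           (l : Sym 1) → IsLen l → (t : Term n) {φ : Form (suc n)} →
           Cls sb p j φ → Cls sb p j (∃≤ s (app l (t ∷ [])) φ)
  c-s∀   : ∀ {p j n} → sb ≡ sharp → (s : Sym 2) → IsLeq s →
           (l : Sym 1) → IsLen l → (t : Term n) {φ : Form (suc n)} →
           Cls sb p j φ → Cls sb p j (∀≤ s (app l (t ∷ [])) φ)

_∷ₑ_ : ∀ {n} → ℕ → (Fin n → ℕ) → Fin (suc n) → ℕ
(a ∷ₑ ρ) zero = a
(a ∷ₑ ρ) (suc i) = ρ i

mutual
  ⟦_⟧ : ∀ {n} → Term n → (Fin n → ℕ) → ℕ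
  ⟦ var i ⟧ ρ = ρ i
  ⟦ 𝟘 ⟧ ρ = 0
  ⟦ 𝟙 ⟧ ρ = 1
  ⟦ app f ts ⟧ ρ = fn f (⟦ ts ⟧s ρ)

  ⟦_⟧s : ∀ {n k} → Vec (Term n) k → (Fin n → ℕ) → Vec ℕ k
  ⟦ [] ⟧s ρ = []
  ⟦ t ∷ ts ⟧s ρ = ⟦ t ⟧ ρ ∷ ⟦ ts ⟧s ρ

Sat : ∀ {n} → (Fin n → ℕ) → Form n → Set
Sat ρ (s ≐ t) = ⟦ s ⟧ ρ ≡ ⟦ t ⟧ ρ
Sat ρ ⊥' = ⊥
Sat ρ (¬' φ) = ¬ Sat ρ φ
Sat ρ (φ ∧' ψ) = Sat ρ φ × Sat ρ ψ
Sat ρ (φ ∨' ψ) = Sat ρ φ ⊎ Sat ρ ψ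
Sat ρ (∀' φ) = (a : ℕ) → Sat (a ∷ₑ ρ) φ
Sat ρ (∃' φ) = Σ ℕ (λ a → Sat (a ∷ₑ ρ) φ)

TrueInℕ : Form 0 → Set
TrueInℕ = Sat (λ ())

data Der (Th : Form 0 → Set) : ∀ {n} → List (Form n) → Form n → Set where
  hyp  : ∀ {n Δ} {φ : Form n} → φ ∈ Δ → Der Th Δ φ
  ax   : ∀ {n} {Δ : List (Form n)} {ψ} → Th ψ → Der Th Δ (close→ ψ)
  ∧I   : ∀ {n Δ} {φ ψ : Form n} → Der Th Δ φ → Der Th Δ ψ → Der Th Δ (φ ∧' ψ)
  ∧E₁  : ∀ {n Δ} {φ ψ : Form n} → Der Th Δ (φ ∧' ψ) → Der Th Δ φ
  ∧E₂  : ∀ {n Δ} {φ ψ : Form n} → Der Th Δ (φ ∧' ψ) → Der Th Δ ψ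
  ∨I₁  : ∀ {n Δ} {φ ψ : Form n} → Der Th Δ φ → Der Th Δ (φ ∨' ψ)
  ∨I₂  : ∀ {n Δ} {φ ψ : Form n} → Der Th Δ ψ → Der Th Δ (φ ∨' ψ)
  ∨E   : ∀ {n Δ} {φ ψ χ : Form n} → Der Th Δ (φ ∨' ψ) →
         Der Th (φ ∷ Δ) χ → Der Th (ψ ∷ Δ) χ → Der Th Δ χ
  ¬I   : ∀ {n Δ} {φ : Form n} → Der Th (φ ∷ Δ) ⊥' → Der Th Δ (¬' φ)
  ¬E   : ∀ {n Δ} {φ : Form n} → Der Th Δ (¬' φ) → Der Th Δ φ → Der Th Δ ⊥'
  raa  : ∀ {n Δ} {φ : Form n} → Der Th (¬' φ ∷ Δ) ⊥' → Der Th Δ φ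
  ∀I   : ∀ {n Δ} {φ : Form (suc n)} →
         Der Th (map (renF suc) Δ) φ → Der Th Δ (∀' φ)
  ∀E   : ∀ {n Δ} {φ : Form (suc n)} → Der Th Δ (∀' φ) →
         (t : Term n) → Der Th Δ (φ [ t ])
  ∃I   : ∀ {n Δ} {φ : Form (suc n)} (t : Term n) →
         Der Th Δ (φ [ t ]) → Der Th Δ (∃' φ)
  ∃E   : ∀ {n Δ} {φ : Form (suc n)} {χ : Form n} → Der Th Δ (∃' φ) →
         Der Th (φ ∷ map (renF suc) Δ) (renF suc χ) → Der Th Δ χ
  ≐refl  : ∀ {n Δ} {t : Term n} → Der Th Δ (t ≐ t)
  ≐subst : ∀ {n Δ} (φ : Form (suc n)) {s t : Term n} →
           Der Th Δ (s ≐ t) → Der Th Δ (φ [ s ]) → Der Th Δ (φ [ t ])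

_⊢_ : (Form 0 → Set) → Form 0 → Set
Th ⊢ ψ = Der Th [] ψ

T-PV : ℕ → Form 0 → Set
T-PV i ψ = Σ ℕ (λ m → Σ (Form m) (λ φ →
             Cls strict Σp (i ∸ 1) φ × (ψ ≡ ∀* φ) × TrueInℕ ψ))

{-# OPTIONS --safe #-}

-- A sharply bounded quantifier Q x ≤ |t| moves inwards past ∃ y ≤ b(x) at the
-- price of coding: it becomes ∃ w ≤ B Q x ≤ |t|, where w codes |t|+1 blocks and
-- y is block x of w; on quantifier-free matrices it is absorbed by a
-- polynomial-time search.  So every sharp Σ_j formula φ is equivalent in ℕ to a
-- prenex strict Σ_j formula N with a single quantifier per level.  Let L = i - 1.
-- If A is Π_L, B is Σ_L and A → B holds in ℕ, then (the universal closure of)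
-- ¬ A ∨ B is an axiom; moreover a leading ∃ of A or ∀ of B may be stripped
-- first.  By induction on φ this proves N ↔ φ for j < L, and N → φ still for
-- j = L.  As φ is true, so is N, hence N is an axiom and φ is provable.

module Submission where

open import Defs
open import Data.Nat using (ℕ; zero; suc; _+_; _*_; _^_; _∸_; _⊓_; _≤_; _<_; _≤ᵇ_; z≤n; s≤s; s≤s⁻¹; >-nonZero; ⌊_/2⌋)
open import Data.Nat.Properties
open import Data.Nat.Logarithm using (⌈log₂_⌉; ⌈log₂2*n⌉≡1+⌈log₂n⌉; ⌈log₂⌈n/2⌉⌉≡⌈log₂n⌉∸1; ⌈log₂⌉-mono-≤)
open import Data.Nat.Induction using (<-rec)
open import Data.Fin using (Fin; zero; suc)
open import Data.Vec using (Vec; []; _∷_; lookup; tabulate)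
open import Data.Vec.Properties using (tabulate∘lookup; lookup∘tabulate)
open import Data.List using (List; []; _∷_)
open import Data.List.Membership.Propositional using (_∈_)
open import Data.List.Membership.Propositional.Properties using (∈-map⁺)
open import Data.List.Relation.Unary.Any using (here; there)
open import Data.Bool using (true; false; T)
open import Data.Product using (Σ; _×_; ∃; _,_; proj₁; proj₂)
open import Data.Product.Function.NonDependent.Propositional using (_×-⇔_)
open import Data.Sum using (_⊎_; inj₁; inj₂)
open import Data.Sum.Function.Propositional using (_⊎-⇔_)
open import Data.Empty using (⊥-elim)
open import Function using (_∘_; id)
open import Function.Bundles using (_⇔_; mk⇔; module Equivalence)
open import Function.Properties.Equivalence using () renaming (refl to ⇔-refl; sym to ⇔-sym; trans to ⇔-trans)
open import Relation.Nullary using (¬_; Dec; yes; no; contradiction)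
open import Relation.Nullary.Decidable using (_×-dec_; _⊎-dec_; ¬?; decidable-stable) renaming (map to map-dec)
open import Relation.Binary.PropositionalEquality using (_≡_; refl; cong; cong₂; trans; subst; module ≡-Reasoning) renaming (sym to ≡-sym)

open Equivalence using (to; from)

-- Substitution

-- What limits φ → `N` to j < L is sharply bounded ∀. Returning from ∀x≤|t| A, with A in Σ_j, to a
-- prenex form is a collection principle, and its antecedent is counted as Π_L only when j < L.
-- Truth needs both directions, provability only N → φ. Negation exchanges the directions, but a
-- change of polarity costs a level, so the inductive hypothesis at j < L suffices for the claim at
-- j + 1 ≤ L. A negation that stays on its level costs nothing, because a Π_j formula is represented
-- through its negation.
--
-- On the coding side, b(x) varies with x and need not be monotone, so the common block width is
-- taken from a monotone majorant of b. Decoded blocks are clipped to b(x), hence every w codes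
-- admissible values and none has to be excluded. Conjunction and disjunction become quantifiers
-- over x ≤ |1|, so one operation on prefixes serves for them as well.

mutual
  renT≡subT : ∀ {n m} {r : Fin n → Fin m} {σ} → (∀ i → σ i ≡ var (r i)) →
    ∀ t → renT r t ≡ subT σ t
  renT≡subT h (var i) = ≡-sym (h i)
  renT≡subT h 𝟘 = refl
  renT≡subT h 𝟙 = refl
  renT≡subT h (app f ts) = cong (app f) (renTs≡subTs h ts)

  renTs≡subTs : ∀ {n m k} {r : Fin n → Fin m} {σ} → (∀ i → σ i ≡ var (r i)) →
    (ts : Vec (Term n) k) → renTs r ts ≡ subTs σ ts
  renTs≡subTs h [] = refl
  renTs≡subTs h (t ∷ ts) = cong₂ _∷_ (renT≡subT h t) (renTs≡subTs h ts)

exts-var : ∀ {n m} {r : Fin n → Fin m} {σ} → (∀ i → σ i ≡ var (r i)) →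
  ∀ i → exts σ i ≡ var (ext r i)
exts-var h zero = refl
exts-var h (suc i) = cong (renT suc) (h i)

renF≡subF : ∀ {n m} {r : Fin n → Fin m} {σ} → (∀ i → σ i ≡ var (r i)) →
  ∀ φ → renF r φ ≡ subF σ φ
renF≡subF h (s ≐ t) = cong₂ _≐_ (renT≡subT h s) (renT≡subT h t)
renF≡subF h ⊥' = refl
renF≡subF h (¬' φ) = cong ¬'_ (renF≡subF h φ)
renF≡subF h (φ ∧' ψ) = cong₂ _∧'_ (renF≡subF h φ) (renF≡subF h ψ)
renF≡subF h (φ ∨' ψ) = cong₂ _∨'_ (renF≡subF h φ) (renF≡subF h ψ)
renF≡subF h (∀' φ) = cong ∀' (renF≡subF (exts-var h) φ)
renF≡subF h (∃' φ) = cong ∃' (renF≡subF (exts-var h) φ)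

mutual
  subT-id : ∀ {n} {σ : Fin n → Term n} → (∀ i → σ i ≡ var i) → ∀ t → subT σ t ≡ t
  subT-id h (var i) = h i
  subT-id h 𝟘 = refl
  subT-id h 𝟙 = refl
  subT-id h (app f ts) = cong (app f) (subTs-id h ts)

  subTs-id : ∀ {n k} {σ : Fin n → Term n} → (∀ i → σ i ≡ var i) →
    (ts : Vec (Term n) k) → subTs σ ts ≡ ts
  subTs-id h [] = refl
  subTs-id h (t ∷ ts) = cong₂ _∷_ (subT-id h t) (subTs-id h ts)

exts-id : ∀ {n} {σ : Fin n → Term n} → (∀ i → σ i ≡ var i) → ∀ i → exts σ i ≡ var i
exts-id h zero = refl
exts-id h (suc i) = cong (renT suc) (h i)

subF-id : ∀ {n} {σ : Fin n → Term n} → (∀ i → σ i ≡ var i) → ∀ φ → subF σ φ ≡ φ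
subF-id h (s ≐ t) = cong₂ _≐_ (subT-id h s) (subT-id h t)
subF-id h ⊥' = refl
subF-id h (¬' φ) = cong ¬'_ (subF-id h φ)
subF-id h (φ ∧' ψ) = cong₂ _∧'_ (subF-id h φ) (subF-id h ψ)
subF-id h (φ ∨' ψ) = cong₂ _∨'_ (subF-id h φ) (subF-id h ψ)
subF-id h (∀' φ) = cong ∀' (subF-id (exts-id h) φ)
subF-id h (∃' φ) = cong ∃' (subF-id (exts-id h) φ)

mutual
  subT-subT : ∀ {n m k} {σ : Fin n → Term m} {τ : Fin m → Term k} {υ} →
    (∀ i → subT τ (σ i) ≡ υ i) → ∀ t → subT τ (subT σ t) ≡ subT υ t
  subT-subT h (var i) = h i
  subT-subT h 𝟘 = refl
  subT-subT h 𝟙 = refl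
  subT-subT h (app f ts) = cong (app f) (subTs-subTs h ts)

  subTs-subTs : ∀ {n m k l} {σ : Fin n → Term m} {τ : Fin m → Term k} {υ} →
    (∀ i → subT τ (σ i) ≡ υ i) → (ts : Vec (Term n) l) →
    subTs τ (subTs σ ts) ≡ subTs υ ts
  subTs-subTs h [] = refl
  subTs-subTs h (t ∷ ts) = cong₂ _∷_ (subT-subT h t) (subTs-subTs h ts)

subT-renT : ∀ {n m k} (r : Fin n → Fin m) (τ : Fin m → Term k) t →
  subT τ (renT r t) ≡ subT (τ ∘ r) t
subT-renT r τ t =
  trans (cong (subT τ) (renT≡subT {σ = var ∘ r} (λ _ → refl) t)) (subT-subT (λ _ → refl) t)

renT-subT : ∀ {n m k} (r : Fin m → Fin k) (σ : Fin n → Term m) t →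
  renT r (subT σ t) ≡ subT (renT r ∘ σ) t
renT-subT r σ t = trans (renT≡subT {σ = var ∘ r} (λ _ → refl) (subT σ t))
  (subT-subT (λ i → ≡-sym (renT≡subT (λ _ → refl) (σ i))) t)

renT-renT : ∀ {n m k} (r : Fin m → Fin k) (q : Fin n → Fin m) t →
  renT r (renT q t) ≡ renT (r ∘ q) t
renT-renT r q t = trans (cong (renT r) (renT≡subT {σ = var ∘ q} (λ _ → refl) t))
  (trans (renT-subT r (var ∘ q) t) (≡-sym (renT≡subT (λ _ → refl) t)))

renT-ext-suc : ∀ {n m} (r : Fin n → Fin m) t →
  renT (ext r) (renT suc t) ≡ renT suc (renT r t)
renT-ext-suc r t = trans (renT-renT (ext r) suc t) (≡-sym (renT-renT suc r t))

exts-comp : ∀ {n m k} {σ : Fin n → Term m} {τ : Fin m → Term k} {υ} →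
  (∀ i → subT τ (σ i) ≡ υ i) → ∀ i → subT (exts τ) (exts σ i) ≡ exts υ i
exts-comp h zero = refl
exts-comp {σ = σ} {τ} h (suc i) =
  trans (subT-renT suc (exts τ) (σ i))
        (trans (≡-sym (renT-subT suc τ (σ i))) (cong (renT suc) (h i)))

subF-subF : ∀ {n m k} {σ : Fin n → Term m} {τ : Fin m → Term k} {υ} →
  (∀ i → subT τ (σ i) ≡ υ i) → ∀ φ → subF τ (subF σ φ) ≡ subF υ φ
subF-subF h (s ≐ t) = cong₂ _≐_ (subT-subT h s) (subT-subT h t)
subF-subF h ⊥' = refl
subF-subF h (¬' φ) = cong ¬'_ (subF-subF h φ)
subF-subF h (φ ∧' ψ) = cong₂ _∧'_ (subF-subF h φ) (subF-subF h ψ)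
subF-subF h (φ ∨' ψ) = cong₂ _∨'_ (subF-subF h φ) (subF-subF h ψ)
subF-subF h (∀' φ) = cong ∀' (subF-subF (exts-comp h) φ)
subF-subF h (∃' φ) = cong ∃' (subF-subF (exts-comp h) φ)

renF-suc-[var] : ∀ {n} (φ : Form (suc n)) → renF (ext suc) φ [ var zero ] ≡ φ
renF-suc-[var] φ =
  trans (cong (subF (single (var zero))) (renF≡subF {σ = var ∘ ext suc} (λ _ → refl) φ))
  (trans (subF-subF {υ = var} (λ { zero → refl ; (suc i) → refl }) φ)
         (subF-id (λ _ → refl) φ))

-- Satisfaction

mutual
  ⟦⟧-sub : ∀ {n m} {σ : Fin n → Term m} {ρ ρ'} → (∀ i → ⟦ σ i ⟧ ρ ≡ ρ' i) →
    ∀ t → ⟦ subT σ t ⟧ ρ ≡ ⟦ t ⟧ ρ'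
  ⟦⟧-sub h (var i) = h i
  ⟦⟧-sub h 𝟘 = refl
  ⟦⟧-sub h 𝟙 = refl
  ⟦⟧-sub h (app f ts) = cong (fn f) (⟦⟧s-sub h ts)

  ⟦⟧s-sub : ∀ {n m k} {σ : Fin n → Term m} {ρ ρ'} → (∀ i → ⟦ σ i ⟧ ρ ≡ ρ' i) →
    (ts : Vec (Term n) k) → ⟦ subTs σ ts ⟧s ρ ≡ ⟦ ts ⟧s ρ'
  ⟦⟧s-sub h [] = refl
  ⟦⟧s-sub h (t ∷ ts) = cong₂ _∷_ (⟦⟧-sub h t) (⟦⟧s-sub h ts)

⟦⟧-ren : ∀ {n m} {r : Fin n → Fin m} {ρ ρ'} → (∀ i → ρ (r i) ≡ ρ' i) →
  ∀ t → ⟦ renT r t ⟧ ρ ≡ ⟦ t ⟧ ρ'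
⟦⟧-ren {r = r} {ρ} h t =
  trans (cong (λ u → ⟦ u ⟧ ρ) (renT≡subT {σ = var ∘ r} (λ _ → refl) t)) (⟦⟧-sub h t)

⟦⟧-suc : ∀ {n a} {ρ : Fin n → ℕ} t → ⟦ renT suc t ⟧ (a ∷ₑ ρ) ≡ ⟦ t ⟧ ρ
⟦⟧-suc = ⟦⟧-ren (λ _ → refl)

⟦⟧-exts : ∀ {n m a} {σ : Fin n → Term m} {ρ ρ'} → (∀ i → ⟦ σ i ⟧ ρ ≡ ρ' i) →
  ∀ i → ⟦ exts σ i ⟧ (a ∷ₑ ρ) ≡ (a ∷ₑ ρ') i
⟦⟧-exts h zero = refl
⟦⟧-exts {σ = σ} h (suc i) = trans (⟦⟧-suc (σ i)) (h i)

¬-⇔ : {A B : Set} → A ⇔ B → (¬ A) ⇔ (¬ B)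
¬-⇔ e = mk⇔ (_∘ from e) (_∘ to e)

Σ-⇔ : {A : Set} {B C : A → Set} → (∀ a → B a ⇔ C a) → Σ A B ⇔ Σ A C
Σ-⇔ e = mk⇔ (λ (a , b) → a , to (e a) b) (λ (a , c) → a , from (e a) c)

Π-⇔ : {A : Set} {B C : A → Set} → (∀ a → B a ⇔ C a) → ((a : A) → B a) ⇔ ((a : A) → C a)
Π-⇔ e = mk⇔ (λ f a → to (e a) (f a)) (λ f a → from (e a) (f a))

→-⇔ : {A B C : Set} → B ⇔ C → (A → B) ⇔ (A → C)
→-⇔ e = mk⇔ (to e ∘_) (from e ∘_)

≡-⇔ : {a b c d : ℕ} → a ≡ c → b ≡ d → (a ≡ b) ⇔ (c ≡ d)
≡-⇔ refl refl = ⇔-refl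

Sat-sub : ∀ {n m} {σ : Fin n → Term m} {ρ ρ'} → (∀ i → ⟦ σ i ⟧ ρ ≡ ρ' i) →
  ∀ φ → Sat ρ (subF σ φ) ⇔ Sat ρ' φ
Sat-sub h (s ≐ t) = ≡-⇔ (⟦⟧-sub h s) (⟦⟧-sub h t)
Sat-sub h ⊥' = ⇔-refl
Sat-sub h (¬' φ) = ¬-⇔ (Sat-sub h φ)
Sat-sub h (φ ∧' ψ) = Sat-sub h φ ×-⇔ Sat-sub h ψ
Sat-sub h (φ ∨' ψ) = Sat-sub h φ ⊎-⇔ Sat-sub h ψ
Sat-sub h (∀' φ) = Π-⇔ (λ a → Sat-sub (⟦⟧-exts h) φ)
Sat-sub h (∃' φ) = Σ-⇔ (λ a → Sat-sub (⟦⟧-exts h) φ)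

Sat-ren : ∀ {n m} {r : Fin n → Fin m} {ρ ρ'} → (∀ i → ρ (r i) ≡ ρ' i) →
  ∀ φ → Sat ρ (renF r φ) ⇔ Sat ρ' φ
Sat-ren {r = r} {ρ} h φ =
  subst (λ ψ → Sat ρ ψ ⇔ _) (≡-sym (renF≡subF {σ = var ∘ r} (λ _ → refl) φ)) (Sat-sub h φ)

Sat-cong : ∀ {n} {ρ ρ' : Fin n → ℕ} → (∀ i → ρ i ≡ ρ' i) → ∀ φ → Sat ρ φ ⇔ Sat ρ' φ
Sat-cong {ρ = ρ} h φ =
  subst (λ ψ → Sat ρ ψ ⇔ Sat _ φ) (subF-id (λ _ → refl) φ) (Sat-sub {σ = var} h φ)

Sat-∀* : ∀ {m} (φ : Form m) → (∀ ρ → Sat ρ (∀* φ)) ⇔ (∀ ρ → Sat ρ φ)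
Sat-∀* {zero} φ = ⇔-refl
Sat-∀* {suc m} φ = ⇔-trans (Sat-∀* (∀' φ)) (mk⇔
  (λ f ρ → to (Sat-cong (λ { zero → refl ; (suc i) → refl }) φ) (f (ρ ∘ suc) (ρ zero)))
  (λ f ρ a → f (a ∷ₑ ρ)))

TrueInℕ-∀* : ∀ {m} (φ : Form m) → TrueInℕ (∀* φ) ⇔ (∀ ρ → Sat ρ φ)
TrueInℕ-∀* φ = ⇔-trans
  (mk⇔ (λ x ρ → to (Sat-cong (λ ()) (∀* φ)) x) (λ f → f _)) (Sat-∀* φ)

leq⇔≤ : ∀ s → IsLeq s → ∀ a b → (fn s (a ∷ b ∷ []) ≡ 1) ⇔ (a ≤ b)
leq⇔≤ s isLeq a b with a ≤ᵇ b in eq | isLeq a b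
... | true | e = mk⇔ (λ _ → ≤ᵇ⇒≤ a b (subst T (≡-sym eq) _)) (λ _ → e)
... | false | e = mk⇔ (λ e' → contradiction (trans (≡-sym e) e') (λ ()))
                      (λ le → ⊥-elim (subst T eq (≤⇒≤ᵇ le)))

Sat-leqF : ∀ {n} {ρ : Fin n → ℕ} s → IsLeq s → ∀ t a →
  Sat (a ∷ₑ ρ) (leqF s (var zero) (renT suc t)) ⇔ (a ≤ ⟦ t ⟧ ρ)
Sat-leqF s isLeq t a = ⇔-trans
  (≡-⇔ (cong (λ b → fn s (a ∷ b ∷ [])) (⟦⟧-suc t)) refl) (leq⇔≤ s isLeq a _)

Sat-∃≤ : ∀ {n} {ρ : Fin n → ℕ} s → IsLeq s → ∀ t φ →
  Sat ρ (∃≤ s t φ) ⇔ (∃ λ a → a ≤ ⟦ t ⟧ ρ × Sat (a ∷ₑ ρ) φ)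
Sat-∃≤ s isLeq t φ = Σ-⇔ (λ a → Sat-leqF s isLeq t a ×-⇔ ⇔-refl)

Sat-∀≤ : ∀ {n} {ρ : Fin n → ℕ} s → IsLeq s → ∀ t φ →
  Sat ρ (∀≤ s t φ) ⇔ (∀ a → a ≤ ⟦ t ⟧ ρ → Sat (a ∷ₑ ρ) φ)
Sat-∀≤ {ρ = ρ} s isLeq t φ = Π-⇔ λ a → mk⇔
  (λ { (inj₁ ¬le) le → contradiction (from (Sat-leqF s isLeq t a) le) ¬le
     ; (inj₂ x) le → x })
  (f a)
  where
    f : ∀ a → (a ≤ ⟦ t ⟧ ρ → Sat (a ∷ₑ ρ) φ) → _
    f a g with a ≤? ⟦ t ⟧ ρ
    ... | yes le = inj₂ (g le)
    ... | no ¬le = inj₁ (¬le ∘ to (Sat-leqF s isLeq t a))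

bounded∃? : {P : ℕ → Set} → (∀ a → Dec (P a)) → ∀ b → Dec (∃ λ a → a ≤ b × P a)
bounded∃? {P} P? b = map-dec
  (mk⇔ {A = ∃ λ a → a < suc b × P a}
    (λ (a , lt , p) → a , s≤s⁻¹ lt , p) (λ (a , le , p) → a , s≤s le , p))
  (anyUpTo? P? (suc b))

bounded∀? : {P : ℕ → Set} → (∀ a → Dec (P a)) → ∀ b → Dec (∀ a → a ≤ b → P a)
bounded∀? P? b = map-dec
  (mk⇔ (λ f a le → f (s≤s le)) (λ f {a} lt → f a (s≤s⁻¹ lt)))
  (allUpTo? P? (suc b))

-- The classes

Cls-lift : ∀ {sb p j L n} {φ : Form n} → j ≤ L → Cls sb p j φ → Cls sb p L φ
Cls-lift {sb} {p} {j} {L} {φ = φ} le c =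
  subst (λ k → Cls sb p k φ) (m∸n+n≡m le) (go (L ∸ j))
  where
    go : ∀ k → Cls sb p (k + j) φ
    go zero = c
    go (suc k) = c-up (go k)

Cls-flip : ∀ {sb p q j L n} {φ : Form n} → j < L → Cls sb p j φ → Cls sb q L φ
Cls-flip lt c = Cls-lift lt (c-up c)

QF-ren : ∀ {n m} {r : Fin n → Fin m} {φ} → QF φ → QF (renF r φ)
QF-ren qf-eq = qf-eq
QF-ren qf-⊥ = qf-⊥
QF-ren (qf-¬ q) = qf-¬ (QF-ren q)
QF-ren (qf-∧ q q') = qf-∧ (QF-ren q) (QF-ren q')
QF-ren (qf-∨ q q') = qf-∨ (QF-ren q) (QF-ren q')

Cls-ren : ∀ {sb p j n m} {r : Fin n → Fin m} {φ} → Cls sb p j φ → Cls sb p j (renF r φ)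
Cls-ren (c-qf q) = c-qf (QF-ren q)
Cls-ren (c-up c) = c-up (Cls-ren c)
Cls-ren (c-∧ c d) = c-∧ (Cls-ren c) (Cls-ren d)
Cls-ren (c-∨ c d) = c-∨ (Cls-ren c) (Cls-ren d)
Cls-ren (c-¬ c) = c-¬ (Cls-ren c)
Cls-ren {r = r} (c-∃≤ s is t c) rewrite renT-ext-suc r t = c-∃≤ s is (renT r t) (Cls-ren c)
Cls-ren {r = r} (c-∀≤ s is t c) rewrite renT-ext-suc r t = c-∀≤ s is (renT r t) (Cls-ren c)
Cls-ren {r = r} (c-s∃ e s is l il t c) rewrite renT-ext-suc r t =
  c-s∃ e s is l il (renT r t) (Cls-ren c)
Cls-ren {r = r} (c-s∀ e s is l il t c) rewrite renT-ext-suc r t =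
  c-s∀ e s is l il (renT r t) (Cls-ren c)

QF? : ∀ {n} {φ : Form n} → QF φ → ∀ ρ → Dec (Sat ρ φ)
QF? (qf-eq {s = s} {t}) ρ = ⟦ s ⟧ ρ ≟ ⟦ t ⟧ ρ
QF? qf-⊥ ρ = no id
QF? (qf-¬ q) ρ = ¬? (QF? q ρ)
QF? (qf-∧ q q') ρ = QF? q ρ ×-dec QF? q' ρ
QF? (qf-∨ q q') ρ = QF? q ρ ⊎-dec QF? q' ρ

-- `Sat` is read constructively. Decidability supplies the classical steps on the semantic side:
-- turning A ⊨ B into the truth of ¬A ∨ B, double negations, De Morgan laws.
Sat? : ∀ {sb p j n} {φ : Form n} → Cls sb p j φ → ∀ ρ → Dec (Sat ρ φ)
Sat? (c-qf q) = QF? q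
Sat? (c-up c) = Sat? c
Sat? (c-∧ c d) ρ = Sat? c ρ ×-dec Sat? d ρ
Sat? (c-∨ c d) ρ = Sat? c ρ ⊎-dec Sat? d ρ
Sat? (c-¬ c) ρ = ¬? (Sat? c ρ)
Sat? (c-∃≤ s is t c) ρ =
  map-dec (⇔-sym (Sat-∃≤ s is t _)) (bounded∃? (λ a → Sat? c (a ∷ₑ ρ)) _)
Sat? (c-∀≤ s is t c) ρ =
  map-dec (⇔-sym (Sat-∀≤ s is t _)) (bounded∀? (λ a → Sat? c (a ∷ₑ ρ)) _)
Sat? (c-s∃ e s is l il t c) ρ =
  map-dec (⇔-sym (Sat-∃≤ s is (app l (t ∷ [])) _)) (bounded∃? (λ a → Sat? c (a ∷ₑ ρ)) _)
Sat? (c-s∀ e s is l il t c) ρ =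
  map-dec (⇔-sym (Sat-∀≤ s is (app l (t ∷ [])) _)) (bounded∀? (λ a → Sat? c (a ∷ₑ ρ)) _)

-- The coding needs symbols for ≤ and |x|. A sharply bounded quantifier brings both along; a formula
-- without one is strict already and, if true, its closure is itself an axiom.
strict-or-symbols : ∀ {sb p j n} {φ : Form n} → Cls sb p j φ →
  Cls strict p j φ ⊎ (Σ (Sym 2) IsLeq × Σ (Sym 1) IsLen)
strict-or-symbols (c-qf q) = inj₁ (c-qf q)
strict-or-symbols (c-up c) with strict-or-symbols c
... | inj₁ c' = inj₁ (c-up c')
... | inj₂ x = inj₂ x
strict-or-symbols (c-∧ c d) with strict-or-symbols c | strict-or-symbols d
... | inj₁ c' | inj₁ d' = inj₁ (c-∧ c' d')
... | inj₂ x | _ = inj₂ x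
... | _ | inj₂ x = inj₂ x
strict-or-symbols (c-∨ c d) with strict-or-symbols c | strict-or-symbols d
... | inj₁ c' | inj₁ d' = inj₁ (c-∨ c' d')
... | inj₂ x | _ = inj₂ x
... | _ | inj₂ x = inj₂ x
strict-or-symbols (c-¬ c) with strict-or-symbols c
... | inj₁ c' = inj₁ (c-¬ c')
... | inj₂ x = inj₂ x
strict-or-symbols (c-∃≤ s is t c) with strict-or-symbols c
... | inj₁ c' = inj₁ (c-∃≤ s is t c')
... | inj₂ x = inj₂ x
strict-or-symbols (c-∀≤ s is t c) with strict-or-symbols c
... | inj₁ c' = inj₁ (c-∀≤ s is t c')
... | inj₂ x = inj₂ x
strict-or-symbols (c-s∃ e s is l il t c) = inj₂ ((s , is) , (l , il))
strict-or-symbols (c-s∀ e s is l il t c) = inj₂ ((s , is) , (l , il))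

-- Derivations

module _ {Th : Form 0 → Set} where

  infix 3 _⊩_
  -- Stands in for implication, which the language does not have. Ranging over all contexts that
  -- contain `A` builds weakening in.
  _⊩_ : ∀ {n} → Form n → Form n → Set
  A ⊩ B = ∀ {Δ} → A ∈ Δ → Der Th Δ B

  private variable
    n : ℕ
    A B C D : Form n
    Δ : List (Form n)

  h₀ : Der Th (A ∷ Δ) A
  h₀ = hyp (here refl)

  h₁ : Der Th (B ∷ A ∷ Δ) A
  h₁ = hyp (there (here refl))

  -- Obtained by case distinction on A ∨ A, with the same derivation in both branches.
  cut : A ⊩ B → Der Th Δ A → Der Th Δ B
  cut {A = A} e d = ∨E (∨I₁ {ψ = A} d) (e (here refl)) (e (here refl))

  ⊥E : Der Th Δ ⊥' → Der Th Δ A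
  ⊥E = cut λ i → raa (hyp (there i))

  infixr 4 _⨾_
  _⨾_ : A ⊩ B → B ⊩ C → A ⊩ C
  (e ⨾ f) i = cut f (e i)

  lem : ∀ A → Der Th Δ (A ∨' (¬' A))
  lem A = raa (¬E h₀ (∨I₂ (¬I (¬E h₁ (∨I₁ h₀)))))

  ∀E-suc : Der Th Δ (renF suc (∀' A)) → Der Th Δ A
  ∀E-suc {A = A} d = subst (Der Th _) (renF-suc-[var] A) (∀E d (var zero))

  ∃I-suc : Der Th Δ A → Der Th Δ (renF suc (∃' A))
  ∃I-suc {A = A} d = ∃I (var zero) (subst (Der Th _) (≡-sym (renF-suc-[var] A)) d)

  inst : ∀ {m k} {Δ : List (Form k)} (σ : Fin m → Term k) (φ : Form m) →
    Der Th Δ (close→ (∀* φ)) → Der Th Δ (subF σ φ)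
  inst {zero} σ φ d = subst (Der Th _) (renF≡subF (λ ()) φ) d
  inst {suc m} σ φ d =
    subst (Der Th _) (subF-subF (λ { zero → refl ; (suc i) →
        trans (subT-renT suc (single (σ zero)) (σ (suc i))) (subT-id (λ _ → refl) _) }) φ)
      -- `∀*` binds variable zero innermost, so the other variables are instantiated first.
      (∀E (inst (σ ∘ suc) (∀' φ) d) (σ zero))

  gen : ∀ {m} (φ : Form m) → Der Th [] φ → Th ⊢ ∀* φ
  gen {zero} φ d = d
  gen {suc m} φ d = gen (∀' φ) (∀I d)

  ax∀* : (φ : Form n) → Th (∀* φ) → Der Th Δ φ
  ax∀* φ t = subst (Der Th _) (subF-id (λ _ → refl) φ) (inst var φ (ax t))

  ∧-mono : A ⊩ C → B ⊩ D → (A ∧' B) ⊩ (C ∧' D)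
  ∧-mono e f i = ∧I (cut e (∧E₁ (hyp i))) (cut f (∧E₂ (hyp i)))

  ∨-mono : A ⊩ C → B ⊩ D → (A ∨' B) ⊩ (C ∨' D)
  ∨-mono e f i = ∨E (hyp i) (∨I₁ (e (here refl))) (∨I₂ (f (here refl)))

  contrapose : A ⊩ B → (¬' B) ⊩ (¬' A)
  contrapose e i = ¬I (¬E (hyp (there i)) (e (here refl)))

  ¬¬-intro : A ⊩ (¬' (¬' A))
  ¬¬-intro i = ¬I (¬E h₀ (hyp (there i)))

  ¬¬-elim : (¬' (¬' A)) ⊩ A
  ¬¬-elim i = raa (¬E (hyp (there i)) h₀)

  ¬∨¬⇒¬∧ : ((¬' A) ∨' (¬' B)) ⊩ (¬' (A ∧' B))
  ¬∨¬⇒¬∧ i = ¬I (∨E (hyp (there i)) (¬E h₀ (∧E₁ h₁)) (¬E h₀ (∧E₂ h₁)))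

  ¬∧⇒¬∨¬ : (¬' (A ∧' B)) ⊩ ((¬' A) ∨' (¬' B))
  ¬∧⇒¬∨¬ {A = A} {B} i = ∨E (lem A)
    (∨I₂ (¬I (¬E (hyp (there (there i))) (∧I h₁ h₀)))) (∨I₁ h₀)

  ¬∧¬⇒¬∨ : ((¬' A) ∧' (¬' B)) ⊩ (¬' (A ∨' B))
  ¬∧¬⇒¬∨ i = ¬I (∨E h₀ (¬E (∧E₁ (hyp (there (there i)))) h₀)
                       (¬E (∧E₂ (hyp (there (there i)))) h₀))

  ¬∨⇒¬∧¬ : (¬' (A ∨' B)) ⊩ ((¬' A) ∧' (¬' B))
  ¬∨⇒¬∧¬ i = ∧I (¬I (¬E (hyp (there i)) (∨I₁ h₀))) (¬I (¬E (hyp (there i)) (∨I₂ h₀)))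

  module _ {s : Sym 2} {t : Term n} where

    ∃≤-mono : A ⊩ B → ∃≤ s t A ⊩ ∃≤ s t B
    ∃≤-mono e i = ∃E (hyp i) (∃I-suc (∧I (∧E₁ h₀) (cut e (∧E₂ h₀))))

    ∀≤-mono : A ⊩ B → ∀≤ s t A ⊩ ∀≤ s t B
    ∀≤-mono e i = ∀I (∨E (∀E-suc (hyp (∈-map⁺ (renF suc) i)))
      (∨I₁ h₀) (∨I₂ (e (here refl))))

    ∀≤¬⇒¬∃≤ : ∀≤ s t (¬' A) ⊩ (¬' ∃≤ s t A)
    ∀≤¬⇒¬∃≤ i = ¬I (∃E h₀ (∨E (∀E-suc (hyp (there (there (∈-map⁺ (renF suc) i)))))
      (¬E h₀ (∧E₁ h₁)) (¬E h₀ (∧E₂ h₁))))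

    ¬∃≤⇒∀≤¬ : (¬' ∃≤ s t A) ⊩ ∀≤ s t (¬' A)
    ¬∃≤⇒∀≤¬ i = ∀I (∨E (lem _)
      (∨I₂ (¬I (¬E (hyp (there (there (∈-map⁺ (renF suc) i)))) (∃I-suc (∧I h₁ h₀)))))
      (∨I₁ h₀))

    ∃≤¬⇒¬∀≤ : ∃≤ s t (¬' A) ⊩ (¬' ∀≤ s t A)
    ∃≤¬⇒¬∀≤ i = ∃E (hyp i) (¬I (∨E (∀E-suc h₀)
      (¬E h₀ (∧E₁ (hyp (there (there (here refl))))))
      (¬E (∧E₂ (hyp (there (there (here refl))))) h₀)))

    ¬∀≤⇒∃≤¬ : (¬' ∀≤ s t A) ⊩ ∃≤ s t (¬' A)
    ¬∀≤⇒∃≤¬ i = raa (¬E (hyp (there i)) (∀I (∨E (lem _)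
      (∨I₂ (raa (¬E (hyp (there (there (here refl)))) (∃I-suc (∧I h₁ h₀)))))
      (∨I₁ h₀))))

-- Entailments obtained from a single axiom

TrueΣ : ℕ → Form 0 → Set
TrueΣ L = T-PV (suc L)

-- An ∃ in front of an antecedent becomes a free variable by `∃E`, as does a ∀ in front of a
-- consequent by `∀I`; the universal closure of the axiom then absorbs it. Hence only what follows
-- the prefix has to lie in Π_L, respectively Σ_L.
data ∃Π (L : ℕ) {n} : Form n → Set where
  base : ∀ {φ : Form n} → Cls strict Πp L φ → ∃Π L φ
  quant : ∀ {φ} → ∃Π L φ → ∃Π L (∃' φ)

data ∀Σ (L : ℕ) {n} : Form n → Set where
  base : ∀ {φ : Form n} → Cls strict Σp L φ → ∀Σ L φ
  quant : ∀ {φ} → ∀Σ L φ → ∀Σ L (∀' φ)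

∀Σ-ren : ∀ {L n m} {r : Fin n → Fin m} {φ} → ∀Σ L φ → ∀Σ L (renF r φ)
∀Σ-ren (base c) = base (Cls-ren c)
∀Σ-ren (quant u) = quant (∀Σ-ren u)

infix 3 _⊨_
_⊨_ : ∀ {n} → Form n → Form n → Set
A ⊨ B = ∀ ρ → Sat ρ A → Sat ρ B

⊨-∃ : ∀ {n A} {B : Form n} → ∃' A ⊨ B → A ⊨ renF suc B
⊨-∃ {A = A} {B} v ρ x = from (Sat-ren (λ _ → refl) B)
  (v (ρ ∘ suc) (ρ zero , to (Sat-cong (λ { zero → refl ; (suc i) → refl }) A) x))

⊨-∀ : ∀ {n} {A : Form n} {B} → A ⊨ ∀' B → renF suc A ⊨ B
⊨-∀ {A = A} {B} v ρ x =
  from (Sat-cong (λ { zero → refl ; (suc i) → refl }) B)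
    (v (ρ ∘ suc) (to (Sat-ren (λ _ → refl) A) x) (ρ zero))

Π-entailment : ∀ {L n} {A B : Form n} → Cls strict Πp L A → ∀Σ L B → A ⊨ B → _⊩_ {TrueΣ L} A B
Π-entailment {A = A} a (quant b) v i =
  ∀I (Π-entailment (Cls-ren a) b (⊨-∀ {A = A} v) (∈-map⁺ (renF suc) i))
Π-entailment {L} {n} {A} {B} a (base b) v i =
  ∨E (ax∀* ((¬' A) ∨' B) (n , _ , c-∨ (c-¬ a) b , refl , from (TrueInℕ-∀* ((¬' A) ∨' B)) w))
     (⊥E (¬E h₀ (hyp (there i)))) h₀
  where
    w : ∀ ρ → (¬ Sat ρ A) ⊎ Sat ρ B
    w ρ with Sat? a ρ
    ... | yes x = inj₂ (v ρ x)
    ... | no ¬x = inj₁ ¬x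

true-entailment : ∀ {L n} {A B : Form n} → ∃Π L A → ∀Σ L B → A ⊨ B → _⊩_ {TrueΣ L} A B
true-entailment (base a) b v = Π-entailment a b v
true-entailment {B = B} (quant a) b v i =
  ∃E (hyp i) (true-entailment a (∀Σ-ren b) (⊨-∃ {B = B} v) (here refl))

-- Binary notation

odd : ℕ → ℕ
odd 0 = 0
odd 1 = 1
odd (suc (suc n)) = odd n

odd≤1 : ∀ n → odd n ≤ 1
odd≤1 0 = z≤n
odd≤1 1 = ≤-refl
odd≤1 (suc (suc n)) = odd≤1 n

⌊2n/2⌋ : ∀ n → ⌊ 2 * n /2⌋ ≡ n
⌊2n/2⌋ n rewrite +-identityʳ n = ≡-sym (n≡⌊n+n/2⌋ n)

⌊1+2n/2⌋ : ∀ n → ⌊ suc (2 * n) /2⌋ ≡ n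
⌊1+2n/2⌋ n rewrite +-identityʳ n = ≡-sym (n≡⌈n+n/2⌉ n)

odd-2n : ∀ n → odd (2 * n) ≡ 0
odd-2n zero = refl
odd-2n (suc n) rewrite *-suc 2 n = odd-2n n

odd-1+2n : ∀ n → odd (suc (2 * n)) ≡ 1
odd-1+2n zero = refl
odd-1+2n (suc n) rewrite +-suc n (n + 0) = odd-1+2n n

data Parity : ℕ → Set where
  2* : ∀ n → Parity (2 * n)
  1+2* : ∀ n → Parity (suc (2 * n))

parity : ∀ n → Parity n
parity zero = 2* 0
parity (suc n) with parity n
... | 2* m = 1+2* m
... | 1+2* m = subst Parity (*-suc 2 m) (2* (suc m))

bitLength-1+2n : ∀ n → bitLength (suc (2 * n)) ≡ suc (bitLength n)
bitLength-1+2n n =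
  trans (cong ⌈log₂_⌉ (≡-sym (*-suc 2 n))) (⌈log₂2*n⌉≡1+⌈log₂n⌉ (suc n))

bitLength-mono : ∀ {m n} → m ≤ n → bitLength m ≤ bitLength n
bitLength-mono le = ⌈log₂⌉-mono-≤ (s≤s le)

bitLength-2n : ∀ n → 0 < n → bitLength (2 * n) ≡ suc (bitLength n)
bitLength-2n n 0<n = begin
  bitLength (2 * n)              ≡⟨ m+[n∸m]≡n {1} (bitLength-mono {1} (≤-trans 0<n (m≤n*m n 2))) ⟨
  suc (bitLength (2 * n) ∸ 1)    ≡⟨ cong suc (⌈log₂⌈n/2⌉⌉≡⌈log₂n⌉∸1 (suc (2 * n))) ⟨
  suc (bitLength ⌊ 2 * n /2⌋)    ≡⟨ cong (suc ∘ bitLength) (⌊2n/2⌋ n) ⟩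
  suc (bitLength n)              ∎
  where open ≡-Reasoning

n<2^bitLength : ∀ n → n < 2 ^ bitLength n
n<2^bitLength = <-rec _ step
  where
    P : ℕ → Set
    P n = n < 2 ^ bitLength n

    twice : ∀ m → 0 < m → P m → P (2 * m)
    twice m 0<m p = subst (λ k → 2 * m < 2 ^ k) (≡-sym (bitLength-2n m 0<m)) (*-monoʳ-< 2 p)

    1+twice : ∀ m → P m → P (suc (2 * m))
    1+twice m p = subst (λ k → suc (2 * m) < 2 ^ k) (≡-sym (bitLength-1+2n m))
      (≤-trans (≤-reflexive (≡-sym (*-suc 2 m))) (*-monoʳ-≤ 2 p))

    step : ∀ n → (∀ {m} → m < n → P m) → P n
    step n ih with parity n
    ... | 2* zero = s≤s z≤n
    ... | 2* m@(suc _) = twice m (s≤s z≤n) (ih (m<m+n m (s≤s z≤n)))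
    ... | 1+2* m = 1+twice m (ih (s≤s (m≤n*m m 2)))

halves : ℕ → ℕ → ℕ
halves zero w = w
halves (suc k) w = ⌊ halves k w /2⌋

halves-+ : ∀ a b w → halves (a + b) w ≡ halves a (halves b w)
halves-+ zero b w = refl
halves-+ (suc a) b w = cong ⌊_/2⌋ (halves-+ a b w)

halves≤ : ∀ k w → halves k w ≤ w
halves≤ zero w = ≤-refl
halves≤ (suc k) w = ≤-trans (⌊n/2⌋≤n _) (halves≤ k w)

if0 : ℕ → ℕ → ℕ → ℕ
if0 zero a b = a
if0 (suc _) a b = b

-- The k lowest bits of w in reversed order.
revBits : ℕ → ℕ → ℕ
revBits zero w = 0
revBits (suc k) w = if0 (odd (halves k w)) (2 * revBits k w) (suc (2 * revBits k w))

revBits< : ∀ k w → revBits k w < 2 ^ k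
revBits< zero w = s≤s z≤n
revBits< (suc k) w with odd (halves k w)
... | zero = *-monoʳ-< 2 (revBits< k w)
... | suc _ = subst (_≤ 2 ^ suc k) (*-suc 2 (revBits k w)) (*-monoʳ-≤ 2 (revBits< k w))

-- Since `revBits` reverses the block, the lowest bit of y lies next to r: it is pushed onto r, and
-- the remaining bits of y are put below by recursion.
prepend : ∀ k y r → y < 2 ^ k →
  ∃ λ w → revBits k w ≡ y × halves k w ≡ r × w < 2 ^ k * suc r
prepend zero zero r lt = r , refl , refl , ≤-reflexive (≡-sym (+-identityʳ _))
prepend zero (suc y) r (s≤s ())
prepend (suc k) y r lt with parity y
... | 2* q with prepend k q (2 * r) (*-cancelˡ-< 2 _ _ lt)
...   | w , e₁ , e₂ , w< = w , e , trans (cong ⌊_/2⌋ e₂) (⌊2n/2⌋ r) ,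
        <-≤-trans w< (≤-trans (*-monoʳ-≤ (2 ^ k) (≤-trans (n≤1+n _) (≤-reflexive (≡-sym (*-suc 2 r)))))
          (≤-reflexive (trans (≡-sym (*-assoc (2 ^ k) 2 (suc r))) (cong (_* suc r) (*-comm (2 ^ k) 2)))))
  where
    e : if0 (odd (halves k w)) (2 * revBits k w) (suc (2 * revBits k w)) ≡ 2 * q
    e rewrite e₂ | e₁ | odd-2n r = refl
prepend (suc k) y r lt | 1+2* q with prepend k q (suc (2 * r)) (*-cancelˡ-< 2 _ _ (<-trans (n<1+n _) lt))
...   | w , e₁ , e₂ , w< = w , e , trans (cong ⌊_/2⌋ e₂) (⌊1+2n/2⌋ r) ,
        <-≤-trans w< (≤-trans (*-monoʳ-≤ (2 ^ k) (≤-reflexive (≡-sym (*-suc 2 r))))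
          (≤-reflexive (trans (≡-sym (*-assoc (2 ^ k) 2 (suc r))) (cong (_* suc r) (*-comm (2 ^ k) 2)))))
  where
    e : if0 (odd (halves k w)) (2 * revBits k w) (suc (2 * revBits k w)) ≡ suc (2 * q)
    e rewrite e₂ | e₁ | odd-1+2n r = refl

encode-blocks : ∀ k N (y : ℕ → ℕ) → (∀ x → x < N → y x < 2 ^ k) →
  ∃ λ w → w < 2 ^ (k * N) × (∀ x → x < N → revBits k (halves (k * x) w) ≡ y x)
encode-blocks k zero y y< rewrite *-zeroʳ k = 0 , s≤s z≤n , λ _ ()
encode-blocks k (suc N) y y< with encode-blocks k N (y ∘ suc) (λ x lt → y< (suc x) (s≤s lt))
... | r , r< , er with prepend k (y 0) r (y< 0 (s≤s z≤n))
...   | w , e₁ , e₂ , w< = w , lt , e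
  where
    lt : w < 2 ^ (k * suc N)
    lt rewrite *-suc k N | ^-distribˡ-+-* 2 k (k * N) = <-≤-trans w< (*-monoʳ-≤ (2 ^ k) r<)
    e : ∀ x → x < suc N → revBits k (halves (k * x) w) ≡ y x
    e zero _ rewrite *-zeroʳ k = e₁
    e (suc x) (s≤s x<) rewrite *-suc k x | +-comm k (k * x) | halves-+ (k * x) k w | e₂ = er x x<

-- Entry x of the sequence of |t|+1 blocks of |s| bits coded by w.
entry : ℕ → ℕ → ℕ → ℕ → ℕ
entry t x s w = revBits (bitLength s) (halves (bitLength s * (bitLength t ⊓ x)) w)

-- The bound is the smash of s and 2t+1: there are |t|+1 = |2t+1| blocks of |s| bits, and |s| bits
-- suffice for every value up to s.
encode : ∀ t s (y : ℕ → ℕ) → (∀ x → x ≤ bitLength t → y x ≤ s) →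
  ∃ λ w → w ≤ 2 ^ (bitLength s * bitLength (suc (2 * t))) ×
          (∀ x → x ≤ bitLength t → entry t x s w ≡ y x)
encode t s y y≤
  with encode-blocks (bitLength s) (suc (bitLength t)) y
         (λ x lt → ≤-<-trans (y≤ x (s≤s⁻¹ lt)) (n<2^bitLength s))
... | w , w< , e = w , w≤ , λ x le →
  trans (cong (λ i → revBits (bitLength s) (halves (bitLength s * i) w)) (m≥n⇒m⊓n≡n le))
        (e x (s≤s le))
  where
    w≤ : w ≤ 2 ^ (bitLength s * bitLength (suc (2 * t)))
    w≤ = subst (λ k → w ≤ 2 ^ (bitLength s * k)) (≡-sym (bitLength-1+2n t)) (<⇒≤ w<)

-- Cobham functions

mutual
  -- Allows auxiliary functions to be programmed as terms instead of by explicit composition.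
  Cobham-term : ∀ {n} (t : Term n) → Cobham n (λ v → ⟦ t ⟧ (lookup v))
  Cobham-term (var i) = c-proj i (λ _ → refl)
  Cobham-term 𝟘 = c-zero (λ _ → refl)
  Cobham-term 𝟙 = c-comp (λ v → suc (2 * lookup v zero)) (λ _ _ → 0)
    (c-s1 (λ _ → refl)) (λ (_ : Fin 1) → c-zero (λ _ → refl)) (λ _ → refl)
  Cobham-term (app f ts) = c-comp (fn f) (λ i v → lookup (⟦ ts ⟧s (lookup v)) i)
    (poly f) (Cobham-terms ts) (λ v → cong (fn f) (≡-sym (tabulate∘lookup _)))

  Cobham-terms : ∀ {n k} (ts : Vec (Term n) k) (i : Fin k) →
    Cobham n (λ v → lookup (⟦ ts ⟧s (lookup v)) i)
  Cobham-terms (t ∷ ts) zero = Cobham-term t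
  Cobham-terms (t ∷ ts) (suc i) = Cobham-terms ts i

-- In the step terms, `var zero` is the argument without its last bit, `var (suc zero)` the previous
-- value, and the parameters follow.
lrn : ∀ {k} (f : Vec ℕ (suc k) → ℕ)
  (g : Term k) (h₀ h₁ : Term (suc (suc k))) (b : Term (suc k)) →
  (∀ ys → f (0 ∷ ys) ≡ ⟦ g ⟧ (lookup ys)) →
  (∀ x ys → 0 < x → f (2 * x ∷ ys) ≡ ⟦ h₀ ⟧ (lookup (x ∷ f (x ∷ ys) ∷ ys))) →
  (∀ x ys → f (suc (2 * x) ∷ ys) ≡ ⟦ h₁ ⟧ (lookup (x ∷ f (x ∷ ys) ∷ ys))) →
  (∀ x ys → f (x ∷ ys) ≤ ⟦ b ⟧ (lookup (x ∷ ys))) → Sym (suc k)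
lrn f g h₀ h₁ b eg e₀ e₁ le = sym f (c-lrn _ _ _ _
  (Cobham-term g) (Cobham-term h₀) (Cobham-term h₁) (Cobham-term b) eg e₀ e₁ le)

pattern v0 = var zero
pattern v1 = var (suc zero)
pattern v2 = var (suc (suc zero))
pattern v3 = var (suc (suc (suc zero)))
pattern v4 = var (suc (suc (suc (suc zero))))

s₀ s₁ : ∀ {n} → Term n → Term n
s₀ t = app (sym (λ v → 2 * lookup v zero) (c-s0 (λ _ → refl))) (t ∷ [])
s₁ t = app (sym (λ v → suc (2 * lookup v zero)) (c-s1 (λ _ → refl))) (t ∷ [])

smash : ∀ {n} → Term n → Term n → Term n
smash t u = app (sym (λ v → 2 ^ (bitLength (lookup v zero) * bitLength (lookup v (suc zero))))
                     (c-smash (λ _ _ → refl))) (t ∷ u ∷ [])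

-- A common upper bound rather than the maximum. Applying `s₁` makes both lengths positive, so
-- neither factor of the exponent can annihilate the other.
_⊔ₜ_ : ∀ {n} → Term n → Term n → Term n
t ⊔ₜ u = smash (s₁ t) (s₁ u)

n≤2^[bitLength[1+2n]*k] : ∀ n {k} → 0 < k → n ≤ 2 ^ (bitLength (suc (2 * n)) * k)
n≤2^[bitLength[1+2n]*k] n {k} 0<k = ≤-trans (<⇒≤ (n<2^bitLength n)) (^-monoʳ-≤ 2
  (≤-trans (bitLength-mono (≤-trans (m≤n*m n 2) (n≤1+n _)))
           (m≤m*n _ k {{>-nonZero 0<k}})))

0<bitLength[1+2n] : ∀ n → 0 < bitLength (suc (2 * n))
0<bitLength[1+2n] n = subst (0 <_) (≡-sym (bitLength-1+2n n)) (s≤s z≤n)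

≤⊔ₜˡ : ∀ {n} (t u : Term n) ρ → ⟦ t ⟧ ρ ≤ ⟦ t ⊔ₜ u ⟧ ρ
≤⊔ₜˡ t u ρ = n≤2^[bitLength[1+2n]*k] (⟦ t ⟧ ρ) (0<bitLength[1+2n] (⟦ u ⟧ ρ))

≤⊔ₜʳ : ∀ {n} (t u : Term n) ρ → ⟦ u ⟧ ρ ≤ ⟦ t ⊔ₜ u ⟧ ρ
≤⊔ₜʳ t u ρ = subst (λ k → ⟦ u ⟧ ρ ≤ 2 ^ k) 
  (*-comm (bitLength (suc (2 * ⟦ u ⟧ ρ))) (bitLength (suc (2 * ⟦ t ⟧ ρ))))
  (n≤2^[bitLength[1+2n]*k] (⟦ u ⟧ ρ) (0<bitLength[1+2n] (⟦ t ⟧ ρ)))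

if0S : Sym 3
if0S = lrn (λ v → if0 (lookup v zero) (lookup v (suc zero)) (lookup v (suc (suc zero))))
  v0 v3 v3 (v1 ⊔ₜ v2)
  (λ _ → refl) (λ { (suc _) _ _ → refl }) (λ _ _ → refl)
  (λ { zero (a ∷ b ∷ []) → ≤⊔ₜˡ v0 v1 (lookup (a ∷ b ∷ []))
     ; (suc _) (a ∷ b ∷ []) → ≤⊔ₜʳ v0 v1 (lookup (a ∷ b ∷ [])) })

if0ₜ : ∀ {n} → Term n → Term n → Term n → Term n
if0ₜ c t u = app if0S (c ∷ t ∷ u ∷ [])

halfS : Sym 1
halfS = lrn (λ v → ⌊ lookup v zero /2⌋) 𝟘 v0 v0 v0
  (λ _ → refl) (λ x _ _ → ⌊2n/2⌋ x) (λ x _ → ⌊1+2n/2⌋ x) (λ x _ → ⌊n/2⌋≤n x)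

oddS : Sym 1
oddS = lrn (λ v → odd (lookup v zero)) 𝟘 𝟘 𝟙 𝟙
  (λ _ → refl) (λ x _ _ → odd-2n x) (λ x _ → odd-1+2n x) (λ x _ → odd≤1 x)

-- The shift is by a length because recursion on notation makes |x| steps, each of which halves once
-- whatever bit it reads.
shiftS : Sym 2
shiftS = lrn (λ v → halves (bitLength (lookup v zero)) (lookup v (suc zero)))
  v0 (app halfS (v1 ∷ [])) (app halfS (v1 ∷ [])) v1
  (λ _ → refl)
  (λ x ys lt → cong (λ k → halves k (lookup ys zero)) (bitLength-2n x lt))
  (λ x ys → cong (λ k → halves k (lookup ys zero)) (bitLength-1+2n x))
  (λ x ys → halves≤ (bitLength x) (lookup ys zero))

revBitsS : Sym 2
revBitsS = lrn (λ v → revBits (bitLength (lookup v zero)) (lookup v (suc zero)))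
  -- As |1| = 1, this limit is 2^|x|.
  𝟘 h h (smash v0 𝟙)
  (λ _ → refl)
  (λ x ys lt → cong (λ k → revBits k (lookup ys zero)) (bitLength-2n x lt))
  (λ x ys → cong (λ k → revBits k (lookup ys zero)) (bitLength-1+2n x))
  (λ x ys → ≤-trans (<⇒≤ (revBits< (bitLength x) (lookup ys zero)))
    (≤-reflexive (cong (2 ^_) (≡-sym (*-identityʳ (bitLength x))))))
  where
    h : Term 3
    h = if0ₜ (app oddS (app shiftS (v0 ∷ v2 ∷ []) ∷ [])) (s₀ v1) (s₁ v1)

-- Monotone majorants of polynomial-time functions

Monotone : ∀ {k} → (Vec ℕ k → ℕ) → Set
Monotone f = ∀ v w → (∀ i → lookup v i ≤ lookup w i) → f v ≤ f w

majorant : ∀ {k f} → Cobham k f → Σ (Sym k) λ M → Monotone (fn M) × (∀ v → f v ≤ fn M v)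
majorant {f = f} c@(c-zero e) =
  sym f c , (λ v w _ → ≤-reflexive (trans (e v) (≡-sym (e w)))) , λ _ → ≤-refl
majorant {f = f} c@(c-s0 e) = sym f c , mono , λ _ → ≤-refl
  where
    mono : Monotone f
    mono (x ∷ []) (y ∷ []) le rewrite e x | e y = *-monoʳ-≤ 2 (le zero)
majorant {f = f} c@(c-s1 e) = sym f c , mono , λ _ → ≤-refl
  where
    mono : Monotone f
    mono (x ∷ []) (y ∷ []) le rewrite e x | e y = s≤s (*-monoʳ-≤ 2 (le zero))
majorant {f = f} c@(c-proj i e) = sym f c , mono , λ _ → ≤-refl
  where
    mono : Monotone f
    mono v w le rewrite e v | e w = le i
majorant {f = f} c@(c-smash e) = sym f c , mono , λ _ → ≤-refl
  where
    mono : Monotone f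
    mono (x ∷ x' ∷ []) (y ∷ y' ∷ []) le rewrite e x x' | e y y' =
      ^-monoʳ-≤ 2 (*-mono-≤ (bitLength-mono (le zero)) (bitLength-mono (le (suc zero))))
majorant {k} {f} (c-comp g hs cg chs e) =
  sym (λ v → fn G (tabulate (λ i → fn (H i) v))) (c-comp (fn G) (fn ∘ H) (poly G) (poly ∘ H) (λ _ → refl)) ,
  (λ v w le → G-mono _ _ (tab-mono (λ i → proj₁ (proj₂ (majorant (chs i))) v w le))) ,
  (λ v → ≤-trans (≤-reflexive (e v)) (≤-trans (proj₂ (proj₂ (majorant cg)) _)
           (G-mono _ _ (tab-mono (λ i → proj₂ (proj₂ (majorant (chs i))) v)))))
  where
    G = proj₁ (majorant cg)
    G-mono = proj₁ (proj₂ (majorant cg))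
    H = λ i → proj₁ (majorant (chs i))
    tab-mono : ∀ {m} {a b : Fin m → ℕ} → (∀ i → a i ≤ b i) →
      ∀ i → lookup (tabulate a) i ≤ lookup (tabulate b) i
    tab-mono {a = a} {b} le i rewrite lookup∘tabulate a i | lookup∘tabulate b i = le i
-- The limit of the recursion bounds f, so a majorant of the limit is one of f.
majorant (c-lrn g h0 h1 b cg ch0 ch1 cb eg e0 e1 le) with majorant cb
... | B , B-mono , b≤B = B , B-mono , λ { (x ∷ ys) → ≤-trans (le x ys) (b≤B (x ∷ ys)) }

vars : ∀ {n} → Vec (Term n) n
vars = tabulate var

lookup-⟦⟧s : ∀ {n k} (ts : Vec (Term n) k) ρ i → lookup (⟦ ts ⟧s ρ) i ≡ ⟦ lookup ts i ⟧ ρ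
lookup-⟦⟧s (t ∷ ts) ρ zero = refl
lookup-⟦⟧s (t ∷ ts) ρ (suc i) = lookup-⟦⟧s ts ρ i

lookup-vars : ∀ {n} (ρ : Fin n → ℕ) i → lookup (⟦ vars ⟧s ρ) i ≡ ρ i
lookup-vars ρ i = trans (lookup-⟦⟧s vars ρ i) (cong (λ t → ⟦ t ⟧ ρ) (lookup∘tabulate var i))

⟦⟧-cong : ∀ {n} {ρ ρ' : Fin n → ℕ} → (∀ i → ρ i ≡ ρ' i) → ∀ t → ⟦ t ⟧ ρ ≡ ⟦ t ⟧ ρ'
⟦⟧-cong {ρ = ρ} h t = trans (cong (λ u → ⟦ u ⟧ ρ) (≡-sym (subT-id (λ _ → refl) t))) (⟦⟧-sub {σ = var} h t)

lookup-∷-vars : ∀ {n} a (ρ : Fin n → ℕ) i → lookup (a ∷ ⟦ vars ⟧s ρ) i ≡ (a ∷ₑ ρ) i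
lookup-∷-vars a ρ zero = refl
lookup-∷-vars a ρ (suc i) = lookup-vars ρ i

-- Substituting t into b would bound b(a) for all a ≤ t only if b were monotone; its majorant is.
maxOver : ∀ {n} → Term n → Term (suc n) → Term n
maxOver t b = app (proj₁ (majorant (Cobham-term b))) (t ∷ vars)

≤maxOver : ∀ {n} t (b : Term (suc n)) ρ a → a ≤ ⟦ t ⟧ ρ → ⟦ b ⟧ (a ∷ₑ ρ) ≤ ⟦ maxOver t b ⟧ ρ
≤maxOver t b ρ a le with majorant (Cobham-term b)
... | M , M-mono , b≤M = ≤-trans (≤-reflexive (≡-sym (⟦⟧-cong (lookup-∷-vars a ρ) b)))
  (≤-trans (b≤M (a ∷ ⟦ vars ⟧s ρ))
           (M-mono _ (⟦ t ⟧ ρ ∷ ⟦ vars ⟧s ρ) λ { zero → le ; (suc i) → ≤-refl }))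

-- A zero of P among 0, …, k if there is one, and k otherwise.
search : (ℕ → ℕ) → ℕ → ℕ
search P zero = 0
search P (suc k) = if0 (P (search P k)) (search P k) (suc k)

search≤ : ∀ P k → search P k ≤ k
search≤ P zero = z≤n
search≤ P (suc k) with P (search P k)
... | zero = ≤-trans (search≤ P k) (n≤1+n k)
... | suc _ = ≤-refl

search-finds : ∀ (P : ℕ → ℕ) k i → i ≤ k → P i ≡ 0 → P (search P k) ≡ 0
search-finds P zero .zero z≤n e = e
search-finds P (suc k) i le e with m≤n⇒m<n∨m≡n le
... | inj₁ lt rewrite search-finds P k i (s≤s⁻¹ lt) e = search-finds P k i (s≤s⁻¹ lt) e
... | inj₂ refl with P (search P k) in eq
...   | zero = eq
...   | suc _ = e

search-cong : {P Q : ℕ → ℕ} → (∀ i → P i ≡ Q i) → ∀ k → search P k ≡ search Q k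
search-cong h zero = refl
search-cong {P} {Q} h (suc k) rewrite search-cong h k | h (search Q k) = refl

Quant : Pol → ℕ → (ℕ → Set) → Set
Quant Σp b P = ∃ λ a → a ≤ b × P a
Quant Πp b P = ∀ a → a ≤ b → P a

Quant-⇔ : ∀ q {b c} {P R : ℕ → Set} → b ≡ c → (∀ a → P a ⇔ R a) → Quant q b P ⇔ Quant q c R
Quant-⇔ Σp refl e = Σ-⇔ (λ a → ⇔-refl ×-⇔ e a)
Quant-⇔ Πp refl e = Π-⇔ (λ a → →-⇔ (e a))

≤-⇔ : {a b c : ℕ} → b ≡ c → (a ≤ b) ⇔ (a ≤ c)
≤-⇔ refl = ⇔-refl

-- Programs and normal forms built on symbols for ≤ and |x|

module Normal (s : Sym 2) (isLeq : IsLeq s) (l : Sym 1) (isLen : IsLen l) where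

  leq : ℕ → ℕ → ℕ
  leq a b = fn s (a ∷ b ∷ [])

  data Compare (a b : ℕ) : Set where
    is≤ : a ≤ b → leq a b ≡ 1 → Compare a b
    is> : b < a → leq a b ≡ 0 → Compare a b

  compare : ∀ a b → Compare a b
  compare a b with a ≤ᵇ b in eq | isLeq a b
  ... | true  | e = is≤ (≤ᵇ⇒≤ a b (subst T (≡-sym eq) _)) e
  ... | false | e = is> (≰⇒> (λ a≤b → subst T eq (≤⇒≤ᵇ a≤b))) e

  clip : ℕ → ℕ → ℕ
  clip b a = if0 (leq a b) 0 a

  clip≤ : ∀ b a → clip b a ≤ b
  clip≤ b a with compare a b
  ... | is≤ a≤b e rewrite e = a≤b
  ... | is> _ e rewrite e = z≤n

  clip-id : ∀ {a b} → a ≤ b → clip b a ≡ a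
  clip-id {a} {b} a≤b with compare a b
  ... | is≤ _ e rewrite e = refl
  ... | is> b<a _ = contradiction a≤b (<⇒≱ b<a)

  clipₜ : ∀ {n} → Term n → Term n → Term n
  clipₜ b t = if0ₜ (app s (t ∷ b ∷ [])) 𝟘 t

  -- Recursion on the notation of t drops one block of |u| bits per step, as long as the number of
  -- steps made is at most x. So |t| ⊓ x blocks are dropped, which explains the minimum in `entry`.
  -- The term `c v0` restores the current argument, whose length counts the steps.
  dropS : Sym 4
  dropS = lrn drop v2 (h s₀) (h s₁) v3
    (λ { (x ∷ u ∷ w ∷ []) → cong (λ k → halves k w) (*-zeroʳ (bitLength u)) })
    (λ { t (x ∷ u ∷ w ∷ []) 0<t → step (2 * t) t x u w (bitLength-2n t 0<t) })
    (λ { t (x ∷ u ∷ w ∷ []) → step (suc (2 * t)) t x u w (bitLength-1+2n t) })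
    (λ { t (x ∷ u ∷ w ∷ []) → halves≤ (bitLength u * (bitLength t ⊓ x)) w })
    where
      drop : Vec ℕ 4 → ℕ
      drop (t ∷ x ∷ u ∷ w ∷ []) = halves (bitLength u * (bitLength t ⊓ x)) w
      h : (∀ {n} → Term n → Term n) → Term 5
      h c = if0ₜ (app s (app l (c v0 ∷ []) ∷ v2 ∷ [])) v1 (app shiftS (v3 ∷ v1 ∷ []))
      step : ∀ t' t x u w → bitLength t' ≡ suc (bitLength t) →
        drop (t' ∷ x ∷ u ∷ w ∷ []) ≡
        if0 (leq (fn l (t' ∷ [])) x) (drop (t ∷ x ∷ u ∷ w ∷ []))
            (halves (bitLength u) (drop (t ∷ x ∷ u ∷ w ∷ [])))
      step t' t x u w e rewrite isLen t' | e = go (bitLength t)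
        where
          go : ∀ m → halves (bitLength u * (suc m ⊓ x)) w ≡
            if0 (leq (suc m) x) (halves (bitLength u * (m ⊓ x)) w)
              (halves (bitLength u) (halves (bitLength u * (m ⊓ x)) w))
          go m with compare (suc m) x
          ... | is≤ m<x e' rewrite e' | m≤n⇒m⊓n≡m m<x | m≤n⇒m⊓n≡m (<⇒≤ m<x)
                | *-suc (bitLength u) m = halves-+ (bitLength u) (bitLength u * m) w
          ... | is> x≤m e' rewrite e' | m≥n⇒m⊓n≡n (<⇒≤ x≤m) | m≥n⇒m⊓n≡n (s≤s⁻¹ x≤m) = refl

  entryₜ : ∀ {n} → Term n → Term n → Term n → Term n → Term n
  entryₜ t x u w = app revBitsS (u ∷ app dropS (t ∷ x ∷ u ∷ w ∷ []) ∷ [])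

  -- A search up to |x| fits into recursion on notation: each step tests only the current candidate
  -- and, should it fail, moves on to the current length.
  searchS : ∀ {n} → Term (suc n) → Sym (suc n)
  searchS {n} χ = lrn f 𝟘 (h s₀) (h s₁) (app l (v0 ∷ []))
    (λ _ → refl)
    (λ x ys 0<x → step (2 * x) x ys (bitLength-2n x 0<x))
    (λ x ys → step (suc (2 * x)) x ys (bitLength-1+2n x))
    (λ x ys → ≤-trans (search≤ (P ys) (bitLength x)) (≤-reflexive (≡-sym (isLen x))))
    where
      P : Vec ℕ n → ℕ → ℕ
      P ys i = ⟦ χ ⟧ (lookup (i ∷ ys))
      f : Vec ℕ (suc n) → ℕ
      f (x ∷ ys) = search (P ys) (bitLength x)
      -- χ is to be evaluated at the previous value of the recursion, so its first variable skips
      -- the recursion argument.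
      r : Fin (suc n) → Fin (suc (suc n))
      r zero = suc zero
      r (suc i) = suc (suc i)
      h : (∀ {n} → Term n → Term n) → Term (suc (suc n))
      h c = if0ₜ (renT r χ) v1 (app l (c v0 ∷ []))
      step : ∀ x' x ys → bitLength x' ≡ suc (bitLength x) →
        f (x' ∷ ys) ≡ if0 (⟦ renT r χ ⟧ (lookup (x ∷ f (x ∷ ys) ∷ ys))) (f (x ∷ ys)) (fn l (x' ∷ []))
      step x' x ys e rewrite isLen x' | e
        | ⟦⟧-ren {r = r} {ρ = lookup (x ∷ f (x ∷ ys) ∷ ys)} {lookup (f (x ∷ ys) ∷ ys)}
            (λ { zero → refl ; (suc i) → refl }) χ = refl

  searchₜ : ∀ {n} → Term n → Term (suc n) → Term n
  searchₜ t χ = app (searchS χ) (t ∷ vars)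

  searchₜ≤ : ∀ {n} t (χ : Term (suc n)) ρ → ⟦ searchₜ t χ ⟧ ρ ≤ bitLength (⟦ t ⟧ ρ)
  searchₜ≤ t χ ρ = search≤ _ _

  searchₜ-finds : ∀ {n} t (χ : Term (suc n)) ρ a → a ≤ bitLength (⟦ t ⟧ ρ) →
    ⟦ χ ⟧ (a ∷ₑ ρ) ≡ 0 → ⟦ χ ⟧ (⟦ searchₜ t χ ⟧ ρ ∷ₑ ρ) ≡ 0
  searchₜ-finds t χ ρ a a≤ e =
    trans (≡-sym (⟦⟧-cong (lookup-∷-vars _ ρ) χ))
      (search-finds (λ i → ⟦ χ ⟧ (lookup (i ∷ ⟦ vars ⟧s ρ))) (bitLength (⟦ t ⟧ ρ)) a a≤
        (trans (⟦⟧-cong (lookup-∷-vars a ρ) χ) e))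

  -- Normal forms

  -- A node is read as ∃y≤b ¬F, so one constructor yields the whole alternating prefix. A leaf t is
  -- read as t = 0: zero stands for truth.
  data NF : ℕ → ℕ → Set where
    leaf : ∀ {n} → Term n → NF 0 n
    node : ∀ {j n} → Term n → NF j (suc n) → NF (suc j) n

  nf : ∀ {j n} → NF j n → Form n
  nf (leaf t) = t ≐ 𝟘
  nf (node b F) = ∃≤ s b (¬' nf F)

  nf-Cls : ∀ {j n} (N : NF j n) → Cls strict Σp j (nf N)
  nf-Cls (leaf t) = c-qf qf-eq
  nf-Cls (node b F) = c-∃≤ s isLeq b (c-up {q = Πp} (c-¬ (nf-Cls F)))

  nf? : ∀ {j n} (N : NF j n) ρ → Dec (Sat ρ (nf N))
  nf? N = Sat? (nf-Cls N)

  nf-∃Π : ∀ {j n L} (N : NF j n) → j ≤ L → ∃Π L (nf N)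
  nf-∃Π (leaf t) _ = base (c-qf qf-eq)
  nf-∃Π (node b F) j<L =
    quant (base (c-∧ (c-qf qf-eq) (Cls-lift (<⇒≤ j<L) (c-¬ (nf-Cls F)))))

  Sat-node : ∀ {j n ρ} (b : Term n) (F : NF j (suc n)) →
    Sat ρ (nf (node b F)) ⇔ (∃ λ a → a ≤ ⟦ b ⟧ ρ × ¬ Sat (a ∷ₑ ρ) (nf F))
  Sat-node b F = Sat-∃≤ s isLeq b (¬' nf F)

  node-⇔ : ∀ {j k m n ρ ρ'} (b : Term m) (F : NF j (suc m)) (c : Term n) (G : NF k (suc n)) →
    ⟦ b ⟧ ρ ≡ ⟦ c ⟧ ρ' → (∀ a → Sat (a ∷ₑ ρ) (nf F) ⇔ Sat (a ∷ₑ ρ') (nf G)) →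
    Sat ρ (nf (node b F)) ⇔ Sat ρ' (nf (node c G))
  node-⇔ b F c G e h = ⇔-trans (Sat-node b F)
    (⇔-trans (Σ-⇔ (λ a → ≤-⇔ e ×-⇔ ¬-⇔ (h a))) (⇔-sym (Sat-node c G)))

  subN : ∀ {j m n} → (Fin m → Term n) → NF j m → NF j n
  subN σ (leaf t) = leaf (subT σ t)
  subN σ (node b F) = node (subT σ b) (subN (exts σ) F)

  Sat-subN : ∀ {j m n} {σ : Fin m → Term n} {ρ ρ'} → (∀ i → ⟦ σ i ⟧ ρ ≡ ρ' i) →
    (N : NF j m) → Sat ρ (nf (subN σ N)) ⇔ Sat ρ' (nf N)
  Sat-subN h (leaf t) = ≡-⇔ (⟦⟧-sub h t) refl
  Sat-subN {σ = σ} h (node b F) =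
    node-⇔ (subT σ b) (subN (exts σ) F) b F (⟦⟧-sub h b) (λ a → Sat-subN (⟦⟧-exts h) F)

  weaken : ∀ {j n} → NF j n → NF j (suc n)
  weaken = subN (var ∘ suc)

  Sat-weaken : ∀ {j n a} {ρ : Fin n → ℕ} (N : NF j n) → Sat (a ∷ₑ ρ) (nf (weaken N)) ⇔ Sat ρ (nf N)
  Sat-weaken = Sat-subN (λ _ → refl)

  -- Prefixes of equal length can share their quantifiers, the condition selecting each bound and
  -- finally the matrix.
  ite : ∀ {j n} → Term n → NF j n → NF j n → NF j n
  ite c (leaf t) (leaf u) = leaf (if0ₜ c t u)
  ite c (node b F) (node d G) = node (if0ₜ c b d) (ite (renT suc c) F G)

  Sat-ite-zero : ∀ {j n ρ} c (F G : NF j n) → ⟦ c ⟧ ρ ≡ 0 → Sat ρ (nf (ite c F G)) ⇔ Sat ρ (nf F)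
  Sat-ite-zero c (leaf t) (leaf u) e = ≡-⇔ (cong (λ z → if0 z _ _) e) refl
  Sat-ite-zero c (node b F) (node d G) e =
    node-⇔ (if0ₜ c b d) (ite (renT suc c) F G) b F (cong (λ z → if0 z _ _) e)
      (λ a → Sat-ite-zero (renT suc c) F G (trans (⟦⟧-suc c) e))

  Sat-ite-suc : ∀ {j n ρ k} c (F G : NF j n) → ⟦ c ⟧ ρ ≡ suc k →
    Sat ρ (nf (ite c F G)) ⇔ Sat ρ (nf G)
  Sat-ite-suc c (leaf t) (leaf u) e = ≡-⇔ (cong (λ z → if0 z _ _) e) refl
  Sat-ite-suc c (node b F) (node d G) e =
    node-⇔ (if0ₜ c b d) (ite (renT suc c) F G) d G (cong (λ z → if0 z _ _) e)
      (λ a → Sat-ite-suc (renT suc c) F G (trans (⟦⟧-suc c) e))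

  notₜ : ∀ {n} → Term n → Term n
  notₜ t = if0ₜ t 𝟙 𝟘

  not-⇔ : ∀ a → (if0 a 1 0 ≡ 0) ⇔ (¬ (a ≡ 0))
  not-⇔ zero = mk⇔ (λ ()) (contradiction refl)
  not-⇔ (suc a) = mk⇔ (λ _ ()) (λ _ → refl)

  -- Normal forms have negation only beneath a quantifier, hence the dummy quantifier bounded by 0.
  negate : ∀ {j n} → NF j n → NF (suc j) n
  negate N = node 𝟘 (weaken N)

  Sat-negate : ∀ {j n ρ} (N : NF j n) → Sat ρ (nf (negate N)) ⇔ (¬ Sat ρ (nf N))
  Sat-negate N = ⇔-trans (Sat-node 𝟘 (weaken N)) (mk⇔
    (λ (a , _ , x) → to (¬-⇔ (Sat-weaken N)) x)
    (λ x → 0 , z≤n , from (¬-⇔ (Sat-weaken N)) x))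

  -- The dummy quantifier is added innermost, where the negation that it introduces cancels against
  -- `notₜ` on the matrix and the prefix keeps its polarities.
  up : ∀ {j n} → NF j n → NF (suc j) n
  up (leaf t) = negate (leaf (notₜ t))
  up (node b F) = node b (up F)

  Sat-up : ∀ {j n ρ} (N : NF j n) → Sat ρ (nf (up N)) ⇔ Sat ρ (nf N)
  Sat-up {ρ = ρ} (leaf t) = ⇔-trans (Sat-negate (leaf (notₜ t)))
    (⇔-trans (¬-⇔ (not-⇔ (⟦ t ⟧ ρ))) (mk⇔ (decidable-stable (_ ≟ _)) contradiction))
  Sat-up (node b F) = node-⇔ b (up F) b F refl (λ a → Sat-up F)

  -- Moving a sharply bounded quantifier inwards

  -- From w to the values: clipping keeps every decoded y within its bound. Conversely, for ∃ a
  -- constant sequence is coded, for ∀ a sequence of chosen witnesses. The quantifier over x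
  -- reappears as its dual because it now stands under the negation of the node.
  swap : ∀ q t S (b : ℕ → ℕ) {R : ℕ → ℕ → Set} → (∀ y x → Dec (R y x)) →
    (∀ x → x ≤ bitLength t → b x ≤ S) →
    (∃ λ w → w ≤ 2 ^ (bitLength S * bitLength (suc (2 * t))) ×
       ¬ Quant (dual q) (bitLength t) (λ x → R (clip (b x) (entry t x S w)) x))
    ⇔ Quant q (bitLength t) (λ x → ∃ λ y → y ≤ b x × ¬ R y x)
  swap Σp t S b {R} R? b≤ = mk⇔ there' back
    where
      there' : _ → _
      there' (w , _ , ¬all) with bounded∃? (λ x → ¬? (R? (clip (b x) (entry t x S w)) x)) (bitLength t)
      ... | yes (x , x≤ , r) = x , x≤ , _ , clip≤ (b x) _ , r
      ... | no ¬ex = contradiction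
        (λ x x≤ → decidable-stable (R? _ _) (λ ¬r → ¬ex (x , x≤ , ¬r))) ¬all
      back : _ → _
      back (x , x≤ , y , y≤ , ¬r) with encode t S (λ _ → y) (λ _ _ → ≤-trans y≤ (b≤ x x≤))
      ... | w , w≤ , e = w , w≤ , λ all →
        ¬r (subst (λ z → R z x) (trans (cong (clip (b x)) (e x x≤)) (clip-id y≤)) (all x x≤))
  swap Πp t S b {R} R? b≤ = mk⇔
    (λ (w , _ , ¬ex) x x≤ → _ , clip≤ (b x) _ , λ r → ¬ex (x , x≤ , r)) back
    where
      choice : (∀ x → x ≤ bitLength t → ∃ λ y → y ≤ b x × ¬ R y x) →
        ∀ x → ∃ λ y → x ≤ bitLength t → y ≤ b x × ¬ R y x
      choice f x with x ≤? bitLength t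
      ... | yes x≤ = proj₁ (f x x≤) , λ _ → proj₂ (f x x≤)
      -- A default beyond |t| makes the choice a total function, as `encode` expects.
      ... | no x≰ = 0 , λ x≤ → contradiction x≤ x≰

      back : _ → _
      back f with encode t S (proj₁ ∘ choice f)
                    (λ x x≤ → ≤-trans (proj₁ (proj₂ (choice f x) x≤)) (b≤ x x≤))
      ... | w , w≤ , e = w , w≤ , λ (x , x≤ , r) → proj₂ (proj₂ (choice f x) x≤)
        (subst (λ z → R z x) (trans (cong (clip (b x)) (e x x≤))
                                    (clip-id (proj₁ (proj₂ (choice f x) x≤)))) r)

  module _ {n} (t : Term n) (b : Term (suc n)) where

    blockBound : Term n
    blockBound = maxOver (app l (t ∷ [])) b

    -- Takes the variables y, x of the matrix to the new context x, w: y becomes the clipped block x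
    -- of w, and x moves to the innermost place.
    swapSub : Fin (suc (suc n)) → Term (suc (suc n))
    swapSub zero = clipₜ (renT (ext suc) b)
      (entryₜ (renT (λ i → suc (suc i)) t) v0 (renT (λ i → suc (suc i)) blockBound) v1)
    swapSub (suc zero) = v0
    swapSub (suc (suc i)) = var (suc (suc i))

    ⟦swapSub⟧ : ∀ ρ w x i → ⟦ swapSub i ⟧ (x ∷ₑ (w ∷ₑ ρ)) ≡
      (clip (⟦ b ⟧ (x ∷ₑ ρ)) (entry (⟦ t ⟧ ρ) x (⟦ blockBound ⟧ ρ) w) ∷ₑ (x ∷ₑ ρ)) i
    ⟦swapSub⟧ ρ w x zero = cong₂ clip
      (⟦⟧-ren (λ { zero → refl ; (suc i) → refl }) b)
      (cong₂ (λ a c → entry a x c w) (⟦⟧-ren (λ _ → refl) t) (⟦⟧-ren (λ _ → refl) blockBound))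
    ⟦swapSub⟧ ρ w x (suc zero) = refl
    ⟦swapSub⟧ ρ w x (suc (suc i)) = refl

  -- For ∃ the matrix is tested at the witness that the search returns, for ∀ at the counterexample;
  -- a failed search still returns a point in range.
  sharpₜ : ∀ {n} → Pol → Term n → Term (suc n) → Term n
  sharpₜ Σp t χ = subT (single (searchₜ t χ)) χ
  sharpₜ Πp t χ = subT (single (searchₜ t (notₜ χ))) χ

  ⟦single⟧ : ∀ {n ρ} (t : Term n) χ → ⟦ subT (single t) χ ⟧ ρ ≡ ⟦ χ ⟧ (⟦ t ⟧ ρ ∷ₑ ρ)
  ⟦single⟧ t χ = ⟦⟧-sub (λ { zero → refl ; (suc i) → refl }) χ

  ⟦sharpₜ⟧ : ∀ {n} q t (χ : Term (suc n)) ρ →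
    (⟦ sharpₜ q t χ ⟧ ρ ≡ 0) ⇔ Quant q (bitLength (⟦ t ⟧ ρ)) (λ a → ⟦ χ ⟧ (a ∷ₑ ρ) ≡ 0)
  ⟦sharpₜ⟧ Σp t χ ρ rewrite ⟦single⟧ {ρ = ρ} (searchₜ t χ) χ =
    mk⇔ (λ e → _ , searchₜ≤ t χ ρ , e) (λ (a , a≤ , e) → searchₜ-finds t χ ρ a a≤ e)
  ⟦sharpₜ⟧ Πp t χ ρ rewrite ⟦single⟧ {ρ = ρ} (searchₜ t (notₜ χ)) χ =
    mk⇔ (λ e a a≤ → decidable-stable (_ ≟ _) λ ne →
           to (not-⇔ _) (searchₜ-finds t (notₜ χ) ρ a a≤ (from (not-⇔ _) ne)) e)
        (λ f → f _ (searchₜ≤ t (notₜ χ) ρ))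

  sharpN : ∀ {j n} → Pol → Term n → NF j (suc n) → NF j n
  sharpN q t (leaf χ) = leaf (sharpₜ q t χ)
  sharpN q t (node b F) = node (smash (blockBound t b) (s₁ t))
    (sharpN (dual q) (renT suc t) (subN (swapSub t b) F))

  Sat-sharpN : ∀ {j n} q t (N : NF j (suc n)) ρ →
    Sat ρ (nf (sharpN q t N)) ⇔ Quant q (bitLength (⟦ t ⟧ ρ)) (λ a → Sat (a ∷ₑ ρ) (nf N))
  Sat-sharpN q t (leaf χ) ρ = ⟦sharpₜ⟧ q t χ ρ
  Sat-sharpN {suc j} q t (node b F) ρ =
    ⇔-trans (Sat-node (smash (blockBound t b) (s₁ t)) (sharpN (dual q) (renT suc t) (subN (swapSub t b) F)))
    (⇔-trans (Σ-⇔ λ w → ⇔-refl ×-⇔ ¬-⇔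
      (⇔-trans (Sat-sharpN (dual q) (renT suc t) (subN (swapSub t b) F) (w ∷ₑ ρ))
        (Quant-⇔ (dual q) (cong bitLength (⟦⟧-suc t))
          (λ x → Sat-subN (⟦swapSub⟧ t b ρ w x) F))))
    (⇔-trans
      (swap q (⟦ t ⟧ ρ) (⟦ blockBound t b ⟧ ρ) (λ x → ⟦ b ⟧ (x ∷ₑ ρ))
        (λ y x → nf? F (y ∷ₑ (x ∷ₑ ρ)))
        (λ x x≤ → ≤maxOver (app l (t ∷ [])) b ρ x (≤-trans x≤ (≤-reflexive (≡-sym (isLen _))))))
      (Quant-⇔ q refl (λ x → ⇔-sym (Sat-node b F)))))

  -- Conjunction (Πp) and disjunction (Σp), as a quantifier over {0, 1}.
  combine : ∀ {j n} → Pol → NF j n → NF j n → NF j n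
  combine q F G = sharpN q 𝟙 (ite v0 (weaken F) (weaken G))

  Sat-combine : ∀ {j n ρ} q (F G : NF j n) → Sat ρ (nf (combine q F G)) ⇔
    Quant q 1 (λ a → Sat (a ∷ₑ ρ) (nf (ite v0 (weaken F) (weaken G))))
  Sat-combine {ρ = ρ} q F G = Sat-sharpN q 𝟙 (ite v0 (weaken F) (weaken G)) ρ

  module _ {j n} {ρ : Fin n → ℕ} (F G : NF j n) where

    Sat-combine-0 : Sat (0 ∷ₑ ρ) (nf (ite v0 (weaken F) (weaken G))) ⇔ Sat ρ (nf F)
    Sat-combine-0 = ⇔-trans (Sat-ite-zero v0 (weaken F) (weaken G) refl) (Sat-weaken F)

    Sat-combine-1 : Sat (1 ∷ₑ ρ) (nf (ite v0 (weaken F) (weaken G))) ⇔ Sat ρ (nf G)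
    Sat-combine-1 = ⇔-trans (Sat-ite-suc v0 (weaken F) (weaken G) refl) (Sat-weaken G)

    Sat-and : Sat ρ (nf (combine Πp F G)) ⇔ Sat ρ (nf F ∧' nf G)
    Sat-and = ⇔-trans (Sat-combine Πp F G) (mk⇔
      (λ f → to Sat-combine-0 (f 0 z≤n) , to Sat-combine-1 (f 1 ≤-refl))
      (λ (x , y) → λ { 0 _ → from Sat-combine-0 x ; 1 _ → from Sat-combine-1 y
                     ; (suc (suc _)) (s≤s ()) }))

    Sat-or : Sat ρ (nf (combine Σp F G)) ⇔ Sat ρ (nf F ∨' nf G)
    Sat-or = ⇔-trans (Sat-combine Σp F G) (mk⇔
      (λ { (0 , _ , x) → inj₁ (to Sat-combine-0 x) ; (1 , _ , y) → inj₂ (to Sat-combine-1 y)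
         ; (suc (suc _) , s≤s () , _) })
      (λ { (inj₁ x) → 0 , z≤n , from Sat-combine-0 x ; (inj₂ y) → 1 , ≤-refl , from Sat-combine-1 y }))

  -- Two consecutive existential quantifiers are merged by coding x and y as entries 0 and 1 of a
  -- sequence of |1|+1 blocks. The bound for y is evaluated at the decoded x.
  pairing : ∀ t S (b : ℕ → ℕ) {P : ℕ → ℕ → Set} → t ≤ S → (∀ x → x ≤ t → b x ≤ S) →
    let fst = λ w → clip t (entry 1 0 S w)
        snd = λ w → clip (b (fst w)) (entry 1 1 S w) in
    (∃ λ w → w ≤ 2 ^ (bitLength S * bitLength (suc (2 * 1))) × P (fst w) (snd w))
    ⇔ (∃ λ x → x ≤ t × ∃ λ y → y ≤ b x × P x y)
  pairing t S b {P} t≤ b≤ = mk⇔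
    (λ (w , _ , p) → _ , clip≤ _ _ , _ , clip≤ _ _ , p)
    (λ (x , x≤ , y , y≤ , p) → back x x≤ y y≤ p)
    where
      fst snd : ℕ → ℕ
      fst w = clip t (entry 1 0 S w)
      snd w = clip (b (fst w)) (entry 1 1 S w)

      back : ∀ x → x ≤ t → ∀ y → y ≤ b x → P x y →
        ∃ λ w → w ≤ 2 ^ (bitLength S * bitLength (suc (2 * 1))) × P (fst w) (snd w)
      back x x≤ y y≤ p with encode 1 S (λ { zero → x ; (suc _) → y })
        (λ { zero _ → ≤-trans x≤ t≤ ; (suc _) _ → ≤-trans y≤ (b≤ x x≤) })
      ... | w , w≤ , e = w , w≤ , subst (λ x' → P x' (snd w)) (≡-sym fst≡)
              (subst (P x) (≡-sym snd≡) p)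
        where
          fst≡ : fst w ≡ x
          fst≡ = trans (cong (clip t) (e 0 z≤n)) (clip-id x≤)
          snd≡ : snd w ≡ y
          snd≡ = trans (cong₂ (λ x' → clip (b x')) fst≡ (e 1 ≤-refl)) (clip-id y≤)

  module _ {n} (t : Term n) (b : Term (suc n)) where

    pairBound : Term n
    pairBound = t ⊔ₜ maxOver t b

    fstₜ sndₜ : Term (suc n)
    fstₜ = clipₜ (renT suc t) (entryₜ 𝟙 𝟘 (renT suc pairBound) v0)
    sndₜ = clipₜ (subT (λ { zero → fstₜ ; (suc i) → var (suc i) }) b)
                 (entryₜ 𝟙 𝟙 (renT suc pairBound) v0)

    pairSub : Fin (suc (suc n)) → Term (suc n)
    pairSub zero = sndₜ
    pairSub (suc zero) = fstₜ
    pairSub (suc (suc i)) = var (suc i)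

    fstₙ sndₙ : (Fin n → ℕ) → ℕ → ℕ
    fstₙ ρ w = clip (⟦ t ⟧ ρ) (entry 1 0 (⟦ pairBound ⟧ ρ) w)
    sndₙ ρ w = clip (⟦ b ⟧ (fstₙ ρ w ∷ₑ ρ)) (entry 1 1 (⟦ pairBound ⟧ ρ) w)

    ⟦fstₜ⟧ : ∀ ρ w → ⟦ fstₜ ⟧ (w ∷ₑ ρ) ≡ fstₙ ρ w
    ⟦fstₜ⟧ ρ w = cong₂ (λ a c → clip a (entry 1 0 c w)) (⟦⟧-suc t) (⟦⟧-suc pairBound)

    ⟦pairSub⟧ : ∀ ρ w i → ⟦ pairSub i ⟧ (w ∷ₑ ρ) ≡ (sndₙ ρ w ∷ₑ (fstₙ ρ w ∷ₑ ρ)) i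
    ⟦pairSub⟧ ρ w zero = cong₂ (λ a c → clip a (entry 1 1 c w))
      (⟦⟧-sub (λ { zero → ⟦fstₜ⟧ ρ w ; (suc i) → refl }) b) (⟦⟧-suc pairBound)
    ⟦pairSub⟧ ρ w (suc zero) = ⟦fstₜ⟧ ρ w
    ⟦pairSub⟧ ρ w (suc (suc i)) = refl

  boundedN : ∀ {j n} → Term n → NF (suc j) (suc n) → NF (suc j) n
  boundedN t (node b F) = node (smash (pairBound t b) (s₁ 𝟙)) (subN (pairSub t b) F)

  Sat-boundedN : ∀ {j n} t (N : NF (suc j) (suc n)) ρ →
    Sat ρ (nf (boundedN t N)) ⇔ (∃ λ a → a ≤ ⟦ t ⟧ ρ × Sat (a ∷ₑ ρ) (nf N))
  Sat-boundedN t (node b F) ρ =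
    ⇔-trans (Sat-node (smash (pairBound t b) (s₁ 𝟙)) (subN (pairSub t b) F))
    (⇔-trans (Σ-⇔ λ w → ⇔-refl ×-⇔ ¬-⇔ (Sat-subN (⟦pairSub⟧ t b ρ w) F))
    (⇔-trans
      (pairing (⟦ t ⟧ ρ) (⟦ pairBound t b ⟧ ρ) (λ x → ⟦ b ⟧ (x ∷ₑ ρ))
        {λ x y → ¬ Sat (y ∷ₑ (x ∷ₑ ρ)) (nf F)}
        (≤⊔ₜˡ t (maxOver t b) ρ)
        (λ x x≤ → ≤-trans (≤maxOver t b ρ x x≤) (≤⊔ₜʳ t (maxOver t b) ρ)))
      (Σ-⇔ (λ x → ⇔-refl ×-⇔ ⇔-sym (Sat-node b F)))))

  -- Quantifier-free formulas

  -- Characteristic term with 0 for truth; equality is tested as two inequalities.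
  qfT : ∀ {n} {φ : Form n} → QF φ → Term n
  qfT (qf-eq {s = t} {u}) = if0ₜ (app s (t ∷ u ∷ [])) 𝟙 (notₜ (app s (u ∷ t ∷ [])))
  qfT qf-⊥ = 𝟙
  qfT (qf-¬ q) = notₜ (qfT q)
  qfT (qf-∧ q r) = if0ₜ (qfT q) (qfT r) 𝟙
  qfT (qf-∨ q r) = if0ₜ (qfT q) 𝟘 (qfT r)

  ⟦qfT⟧ : ∀ {n} {φ : Form n} (q : QF φ) ρ → (⟦ qfT q ⟧ ρ ≡ 0) ⇔ Sat ρ φ
  ⟦qfT⟧ (qf-eq {s = t} {u}) ρ with compare (⟦ t ⟧ ρ) (⟦ u ⟧ ρ) | compare (⟦ u ⟧ ρ) (⟦ t ⟧ ρ)
  ... | is> lt e | _ rewrite e = mk⇔ (λ ()) (λ eq → contradiction eq (>⇒≢ lt))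
  ... | is≤ _ e | is> lt e' rewrite e | e' = mk⇔ (λ ()) (λ eq → contradiction eq (<⇒≢ lt))
  ... | is≤ t≤u e | is≤ u≤t e' rewrite e | e' = mk⇔ (λ _ → ≤-antisym t≤u u≤t) (λ _ → refl)
  ⟦qfT⟧ qf-⊥ ρ = mk⇔ (λ ()) ⊥-elim
  ⟦qfT⟧ (qf-¬ q) ρ = ⇔-trans (not-⇔ _) (¬-⇔ (⟦qfT⟧ q ρ))
  ⟦qfT⟧ (qf-∧ q r) ρ = ⇔-trans (if0-∧ (⟦ qfT q ⟧ ρ)) (⟦qfT⟧ q ρ ×-⇔ ⟦qfT⟧ r ρ)
    where
      if0-∧ : ∀ a {b} → (if0 a b 1 ≡ 0) ⇔ (a ≡ 0 × b ≡ 0)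
      if0-∧ zero = mk⇔ (refl ,_) proj₂
      if0-∧ (suc a) = mk⇔ (λ ()) (λ ())
  ⟦qfT⟧ (qf-∨ q r) ρ = ⇔-trans (if0-∨ (⟦ qfT q ⟧ ρ)) (⟦qfT⟧ q ρ ⊎-⇔ ⟦qfT⟧ r ρ)
    where
      if0-∨ : ∀ a {b} → (if0 a 0 b ≡ 0) ⇔ (a ≡ 0 ⊎ b ≡ 0)
      if0-∨ zero = mk⇔ (λ _ → inj₁ refl) (λ _ → refl)
      if0-∨ (suc a) = mk⇔ inj₂ (λ { (inj₁ ()) ; (inj₂ e) → e })

  qfN : ∀ {n} {φ : Form n} j → QF φ → NF j n
  qfN zero q = leaf (qfT q)
  qfN (suc j) q = up (qfN j q)

  Sat-qfN : ∀ {n} {φ : Form n} j (q : QF φ) ρ → Sat ρ (nf (qfN j q)) ⇔ Sat ρ φ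
  Sat-qfN zero q ρ = ⟦qfT⟧ q ρ
  Sat-qfN (suc j) q ρ = ⇔-trans (Sat-up (qfN j q)) (Sat-qfN j q ρ)

  -- Representing formulas by normal forms

  -- In the end `sem` transfers truth from A to `N`, and `down` transfers provability from `N` to A.
  -- The field `up⊩` is there for negations.
  record Rep (L j : ℕ) {n} (A : Form n) : Set where
    field
      N    : NF j n
      sem  : ∀ ρ → Sat ρ (nf N) ⇔ Sat ρ A
      down : j ≤ L → _⊩_ {TrueΣ L} (nf N) A
      up⊩  : j < L → _⊩_ {TrueΣ L} A (nf N)

  module _ {L : ℕ} where
    open Rep

    nf-∀Σ : ∀ {j n} (N : NF j n) → j ≤ L → ∀Σ L (nf N)
    nf-∀Σ N j≤L = base (Cls-lift j≤L (nf-Cls N))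

    Rep-cong : ∀ {j n} {A B : Form n} → (∀ ρ → Sat ρ A ⇔ Sat ρ B) →
      _⊩_ {TrueΣ L} A B → _⊩_ {TrueΣ L} B A → Rep L j A → Rep L j B
    Rep-cong e A⊩B B⊩A R = record
      { N = N R
      ; sem = λ ρ → ⇔-trans (sem R ρ) (e ρ)
      ; down = λ le → down R le ⨾ A⊩B
      ; up⊩ = λ lt → B⊩A ⨾ up⊩ R lt }

    Rep-qf : ∀ {n} {A : Form n} j → QF A → Rep L j A
    Rep-qf j q = record
      { N = qfN j q
      ; sem = Sat-qfN j q
      ; down = λ le → true-entailment (nf-∃Π (qfN j q) le) (base (c-qf q))
          (λ ρ → to (Sat-qfN j q ρ))
      ; up⊩ = λ lt → true-entailment (base (c-qf q)) (nf-∀Σ (qfN j q) (<⇒≤ lt))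
          (λ ρ → from (Sat-qfN j q ρ)) }

    Rep-up : ∀ {j n} {A : Form n} → Rep L j A → Rep L (suc j) A
    Rep-up R = record
      { N = up (N R)
      ; sem = λ ρ → ⇔-trans (Sat-up (N R)) (sem R ρ)
      ; down = λ j<L → true-entailment (nf-∃Π (up (N R)) j<L) (nf-∀Σ (N R) (<⇒≤ j<L))
            (λ ρ → to (Sat-up (N R)))
          ⨾ down R (<⇒≤ j<L)
      ; up⊩ = λ lt → up⊩ R (<⇒≤ lt)
          ⨾ true-entailment (nf-∃Π (N R) (<⇒≤ (<⇒≤ lt))) (nf-∀Σ (up (N R)) (<⇒≤ lt))
              (λ ρ → from (Sat-up (N R))) }

    -- Contraposition turns `up⊩` at level j into `down` at level j + 1; their ranges j < L and j +
    -- 1 ≤ L coincide.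
    Rep-¬ : ∀ {j n} {A : Form n} → Rep L j A → Rep L (suc j) (¬' A)
    Rep-¬ R = record
      { N = negate (N R)
      ; sem = λ ρ → ⇔-trans (Sat-negate (N R)) (¬-⇔ (sem R ρ))
      ; down = λ j<L → true-entailment (nf-∃Π (negate (N R)) j<L)
            (base (c-¬ (Cls-flip j<L (nf-Cls (N R))))) (λ ρ → to (Sat-negate (N R)))
          ⨾ contrapose (up⊩ R j<L)
      ; up⊩ = λ lt → contrapose (down R (<⇒≤ (<⇒≤ lt)))
          ⨾ true-entailment (base (c-¬ (Cls-lift (<⇒≤ (<⇒≤ lt)) (nf-Cls (N R)))))
              (nf-∀Σ (negate (N R)) (<⇒≤ lt)) (λ ρ → from (Sat-negate (N R))) }

    -- The inductive hypotheses exchange the components for their normal forms, and a single axiom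
    -- compares the conjunction of these with `M`. For `up⊩` this conjunction is a Σ_j antecedent,
    -- which j < L makes Π_L.
    Rep-∧ : ∀ {j n} {A B : Form n} → Rep L j A → Rep L j B → Rep L j (A ∧' B)
    Rep-∧ {j} {n} R S = record
      { N = M
      ; sem = λ ρ → ⇔-trans (Sat-and (N R) (N S)) (sem R ρ ×-⇔ sem S ρ)
      ; down = λ le → true-entailment (nf-∃Π M le)
            (base (Cls-lift le (c-∧ (nf-Cls (N R)) (nf-Cls (N S)))))
            (λ ρ → to (Sat-and (N R) (N S)))
          ⨾ ∧-mono (down R le) (down S le)
      ; up⊩ = λ lt → ∧-mono (up⊩ R lt) (up⊩ S lt)
          ⨾ true-entailment (base (Cls-flip lt (c-∧ (nf-Cls (N R)) (nf-Cls (N S)))))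
              (nf-∀Σ M (<⇒≤ lt)) (λ ρ → from (Sat-and (N R) (N S))) }
      where
        M : NF j n
        M = combine Πp (N R) (N S)

    Rep-∨ : ∀ {j n} {A B : Form n} → Rep L j A → Rep L j B → Rep L j (A ∨' B)
    Rep-∨ {j} {n} R S = record
      { N = M
      ; sem = λ ρ → ⇔-trans (Sat-or (N R) (N S)) (sem R ρ ⊎-⇔ sem S ρ)
      ; down = λ le → true-entailment (nf-∃Π M le)
            (base (Cls-lift le (c-∨ (nf-Cls (N R)) (nf-Cls (N S)))))
            (λ ρ → to (Sat-or (N R) (N S)))
          ⨾ ∨-mono (down R le) (down S le)
      ; up⊩ = λ lt → ∨-mono (up⊩ R lt) (up⊩ S lt)
          ⨾ true-entailment (base (Cls-flip lt (c-∨ (nf-Cls (N R)) (nf-Cls (N S)))))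
              (nf-∀Σ M (<⇒≤ lt)) (λ ρ → from (Sat-or (N R) (N S))) }
      where
        M : NF j n
        M = combine Σp (N R) (N S)

    -- For `up⊩` the leading ∃ of the antecedent is stripped. The entailment from `M` is left to the
    -- caller, since the strict classes contain ∃≤ only from level 1 on.
    Rep-∃≤-by : ∀ {j n} (s' : Sym 2) (t : Term n) {A} (R : Rep L j A) (M : NF j n) →
      (∀ ρ → Sat ρ (nf M) ⇔ Sat ρ (∃≤ s' t (nf (N R)))) →
      (j ≤ L → _⊩_ {TrueΣ L} (nf M) (∃≤ s' t (nf (N R)))) →
      Rep L j (∃≤ s' t A)
    Rep-∃≤-by s' t R M e d = record
      { N = M
      ; sem = λ ρ → ⇔-trans (e ρ) (Σ-⇔ (λ a → ⇔-refl ×-⇔ sem R _))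
      ; down = λ le → d le ⨾ ∃≤-mono (down R le)
      ; up⊩ = λ lt → ∃≤-mono (up⊩ R lt)
          ⨾ true-entailment (quant (base (c-∧ (c-qf qf-eq) (Cls-flip lt (nf-Cls (N R))))))
              (nf-∀Σ M (<⇒≤ lt)) (λ ρ → from (e ρ)) }

    Rep-∃≤ : ∀ {j n} s' → IsLeq s' → (t : Term n) {A : Form (suc n)} →
      Rep L (suc j) A → Rep L (suc j) (∃≤ s' t A)
    Rep-∃≤ s' isLeq' t R = Rep-∃≤-by s' t R M e
      -- Matching on the inequality exposes L as a successor, as `c-∃≤` requires.
      (λ { le@(s≤s _) → true-entailment (nf-∃Π M le)
             (base (c-∃≤ s' isLeq' t (Cls-lift le (nf-Cls (N R))))) (λ ρ → to (e ρ)) })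
      where
        M : NF _ _
        M = boundedN t (N R)
        e : ∀ ρ → Sat ρ (nf M) ⇔ Sat ρ (∃≤ s' t (nf (N R)))
        e ρ = ⇔-trans (Sat-boundedN t (N R) ρ) (⇔-sym (Sat-∃≤ s' isLeq' t _))

    module _ {n} (s' : Sym 2) (isLeq' : IsLeq s') (l' : Sym 1) (isLen' : IsLen l') (t : Term n) where

      private
        ∣t∣ : Term n
        ∣t∣ = app l' (t ∷ [])

      Sat-sharp∃ : ∀ {j} (N : NF j (suc n)) ρ →
        Sat ρ (nf (sharpN Σp t N)) ⇔ Sat ρ (∃≤ s' ∣t∣ (nf N))
      Sat-sharp∃ N ρ = ⇔-trans (Sat-sharpN Σp t N ρ)
        (⇔-trans (Quant-⇔ Σp (≡-sym (isLen' _)) (λ _ → ⇔-refl)) (⇔-sym (Sat-∃≤ s' isLeq' ∣t∣ _)))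

      Sat-sharp∀ : ∀ {j} (N : NF j (suc n)) ρ →
        Sat ρ (nf (sharpN Πp t N)) ⇔ Sat ρ (∀≤ s' ∣t∣ (nf N))
      Sat-sharp∀ N ρ = ⇔-trans (Sat-sharpN Πp t N ρ)
        (⇔-trans (Quant-⇔ Πp (≡-sym (isLen' _)) (λ _ → ⇔-refl)) (⇔-sym (Sat-∀≤ s' isLeq' ∣t∣ _)))

      -- At level 0 the search symbol itself names the witness; above, ∃≤ stays within Σ^b_L.
      sharp∃-down : ∀ {j} (N : NF j (suc n)) → j ≤ L →
        _⊩_ {TrueΣ L} (nf (sharpN Σp t N)) (∃≤ s' ∣t∣ (nf N))
      sharp∃-down (leaf χ) z≤n i = ∃I (searchₜ t χ)
        (true-entailment (base (c-qf qf-eq)) (base (c-qf (qf-∧ qf-eq qf-eq))) valid i)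
        where
          μ : Term n
          μ = searchₜ t χ
          valid : (subT (single μ) χ ≐ 𝟘) ⊨
            (leqF s' v0 (renT suc ∣t∣) ∧' (χ ≐ 𝟘)) [ μ ]
          valid ρ x = from (leq⇔≤ s' isLeq' _ _)
            (≤-trans (searchₜ≤ t χ ρ) (≤-reflexive (≡-sym
              (trans (isLen' _) (cong bitLength (trans (⟦single⟧ μ (renT suc t)) (⟦⟧-suc t))))))) , x
      sharp∃-down N@(node _ _) le@(s≤s _) = true-entailment (nf-∃Π (sharpN Σp t N) le)
        (base (c-∃≤ s' isLeq' ∣t∣ (Cls-lift le (nf-Cls N)))) (λ ρ → to (Sat-sharp∃ N ρ))

      Rep-sharp∃ : ∀ {j A} → Rep L j A → Rep L j (∃≤ s' ∣t∣ A)
      Rep-sharp∃ R = Rep-∃≤-by s' ∣t∣ R (sharpN Σp t (N R)) (Sat-sharp∃ (N R)) (sharp∃-down (N R))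

      -- For `down` the ∀ of the consequent is stripped, which leaves ¬(x ≤ |t|) ∨ Σ_L and works
      -- even at j = L. The axiom in `up⊩` is sharply bounded collection, with an antecedent in Π_L
      -- because j < L.
      Rep-sharp∀ : ∀ {j A} → Rep L j A → Rep L j (∀≤ s' ∣t∣ A)
      Rep-sharp∀ {j} R = record
        { N = M
        ; sem = λ ρ → ⇔-trans (Sat-sharp∀ (N R) ρ) (Π-⇔ (λ a → ⇔-refl ⊎-⇔ sem R _))
        ; down = λ le → true-entailment (nf-∃Π M le)
              (quant (base (c-∨ (c-¬ (c-qf qf-eq)) (Cls-lift le (nf-Cls (N R))))))
              (λ ρ → to (Sat-sharp∀ (N R) ρ))
            ⨾ ∀≤-mono (down R le)
        ; up⊩ = λ { lt@(s≤s _) → ∀≤-mono (up⊩ R lt)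
            ⨾ true-entailment (base (c-∀≤ s' isLeq' ∣t∣ (Cls-flip lt (nf-Cls (N R)))))
                (nf-∀Σ M (<⇒≤ lt)) (λ ρ → from (Sat-sharp∀ (N R) ρ)) } }
        where
          M : NF j n
          M = sharpN Πp t (N R)

    -- Normal forms begin with ∃, so a Π_j formula is represented by way of its negation.
    target : ∀ {n} → Pol → Form n → Form n
    target Σp φ = φ
    target Πp φ = ¬' φ

    ¬¬-⇔ : {A : Set} → Dec A → (¬ ¬ A) ⇔ A
    ¬¬-⇔ A? = mk⇔ (decidable-stable A?) contradiction

    ¬⊎¬-⇔ : {A B : Set} → Dec A → ((¬ A) ⊎ (¬ B)) ⇔ (¬ (A × B))
    ¬⊎¬-⇔ (yes a) = mk⇔ (λ { (inj₁ ¬a) (a , _) → ¬a a ; (inj₂ ¬b) (_ , b) → ¬b b })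
      (λ f → inj₂ (λ b → f (a , b)))
    ¬⊎¬-⇔ (no ¬a) = mk⇔ (λ _ (a , _) → ¬a a) (λ _ → inj₁ ¬a)

    ¬×¬-⇔ : {A B : Set} → ((¬ A) × (¬ B)) ⇔ (¬ (A ⊎ B))
    ¬×¬-⇔ = mk⇔ (λ (f , g) → λ { (inj₁ a) → f a ; (inj₂ b) → g b })
      (λ h → h ∘ inj₁ , h ∘ inj₂)

    Sat-∃≤¬ : ∀ {n ρ} s' → IsLeq s' → (t : Term n) (A : Form (suc n)) →
      (∀ ρ → Dec (Sat ρ A)) → Sat ρ (∃≤ s' t (¬' A)) ⇔ Sat ρ (¬' ∀≤ s' t A)
    Sat-∃≤¬ {ρ = ρ} s' isLeq' t A A? = ⇔-trans (Sat-∃≤ s' isLeq' t (¬' A))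
      (⇔-trans (mk⇔ (λ (a , a≤ , ¬x) f → ¬x (f a a≤)) back) (¬-⇔ (⇔-sym (Sat-∀≤ s' isLeq' t A))))
      where
        back : ¬ (∀ a → a ≤ ⟦ t ⟧ ρ → Sat (a ∷ₑ ρ) A) → ∃ λ a → a ≤ ⟦ t ⟧ ρ × ¬ Sat (a ∷ₑ ρ) A
        back ¬f with bounded∃? (λ a → ¬? (A? (a ∷ₑ ρ))) (⟦ t ⟧ ρ)
        ... | yes x = x
        ... | no ¬x = contradiction
          (λ a a≤ → decidable-stable (A? _) (λ ¬y → ¬x (a , a≤ , ¬y))) ¬f

    Sat-∀≤¬ : ∀ {n ρ} s' → IsLeq s' → (t : Term n) (A : Form (suc n)) →
      Sat ρ (∀≤ s' t (¬' A)) ⇔ Sat ρ (¬' ∃≤ s' t A)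
    Sat-∀≤¬ s' isLeq' t A = ⇔-trans (Sat-∀≤ s' isLeq' t (¬' A))
      (⇔-trans (mk⇔ (λ f (a , a≤ , x) → f a a≤ x) (λ f a a≤ x → f (a , a≤ , x)))
               (¬-⇔ (⇔-sym (Sat-∃≤ s' isLeq' t A))))

    -- `Rep-¬` is called only where `c-up` changes polarity, that is, where a level is gained. All
    -- other negations are moved by De Morgan laws, under which the cases for Πp reduce to the dual
    -- constructions.
    represent : ∀ {p j n} {φ : Form n} → Cls sharp p j φ → Rep L j (target p φ)
    represent {Σp} {j} (c-qf q) = Rep-qf j q
    represent {Πp} {j} (c-qf q) = Rep-qf j (qf-¬ q)
    represent {Σp} (c-up {q = Σp} c) = Rep-up (represent c)
    represent {Σp} (c-up {q = Πp} c) =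
      Rep-cong (λ ρ → ¬¬-⇔ (Sat? c ρ)) ¬¬-elim ¬¬-intro (Rep-¬ (represent c))
    represent {Πp} (c-up {q = Σp} c) = Rep-¬ (represent c)
    represent {Πp} (c-up {q = Πp} c) = Rep-up (represent c)
    represent {Σp} (c-∧ c d) = Rep-∧ (represent c) (represent d)
    represent {Πp} (c-∧ c d) = Rep-cong (λ ρ → ¬⊎¬-⇔ (Sat? c ρ)) ¬∨¬⇒¬∧ ¬∧⇒¬∨¬
      (Rep-∨ (represent c) (represent d))
    represent {Σp} (c-∨ c d) = Rep-∨ (represent c) (represent d)
    represent {Πp} (c-∨ c d) = Rep-cong (λ ρ → ¬×¬-⇔) ¬∧¬⇒¬∨ ¬∨⇒¬∧¬
      (Rep-∧ (represent c) (represent d))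
    represent {Σp} (c-¬ c) = represent c
    represent {Πp} (c-¬ c) =
      Rep-cong (λ ρ → ⇔-sym (¬¬-⇔ (Sat? c ρ))) ¬¬-intro ¬¬-elim (represent c)
    represent (c-∃≤ s' is t c) = Rep-∃≤ s' is t (represent c)
    represent (c-∀≤ s' is t {φ} c) =
      Rep-cong (λ ρ → Sat-∃≤¬ s' is t φ (Sat? c)) ∃≤¬⇒¬∀≤ ¬∀≤⇒∃≤¬
        (Rep-∃≤ s' is t (represent c))
    represent {Σp} (c-s∃ _ s' is l' il t c) = Rep-sharp∃ s' is l' il t (represent c)
    represent {Πp} (c-s∃ _ s' is l' il t {φ} c) =
      Rep-cong (λ ρ → Sat-∀≤¬ s' is (app l' (t ∷ [])) φ) ∀≤¬⇒¬∃≤ ¬∃≤⇒∀≤¬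
        (Rep-sharp∀ s' is l' il t (represent c))
    represent {Σp} (c-s∀ _ s' is l' il t c) = Rep-sharp∀ s' is l' il t (represent c)
    represent {Πp} (c-s∀ _ s' is l' il t {φ} c) =
      Rep-cong (λ ρ → Sat-∃≤¬ s' is (app l' (t ∷ [])) φ (Sat? c)) ∃≤¬⇒¬∀≤ ¬∀≤⇒∃≤¬
        (Rep-sharp∃ s' is l' il t (represent c))

theoremA4 : (i : ℕ) → 1 ≤ i → (m : ℕ) (φ : Form m) →
    Cls sharp Σp (i ∸ 1) φ → TrueInℕ (∀* φ) → T-PV i ⊢ ∀* φ
theoremA4 i _ m φ c φ-true with strict-or-symbols c
... | inj₁ c' = gen φ (ax∀* φ (m , φ , c' , refl , φ-true))
... | inj₂ ((s , isLeq) , (l , isLen)) = gen φ (cut (down ≤-refl)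
    (ax∀* (nf N) (m , nf N , nf-Cls N , refl ,
      from (TrueInℕ-∀* (nf N)) (λ ρ → from (sem ρ) (to (TrueInℕ-∀* φ) φ-true ρ)))))
  where
    open Normal s isLeq l isLen
    open Rep (represent {i ∸ 1} c)
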